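{- (1) For every $\Sigma_3$ quantifier-pattern $\bar{\mathsf Q}$ there is $\bar{\mathsf P}$ among the following $3$ patterns with $\langle\bar{\mathsf Q}\rangle\equiv_{\sf m}\langle\bar{\mathsf P}\rangle$: $\exists\forall\exists,\ \forall^\infty\exists^\infty,\ \forall^\infty\exists$. (2) For every $\Pi_3$ quantifier-pattern $\bar{\mathsf Q}$ there is $\bar{\mathsf P}$ among the following $5$ patterns with $\langle\bar{\mathsf Q}\rangle\equiv_{\sf m}\langle\bar{\mathsf P}\rangle$: $\forall\exists\forall,\ \exists^\infty\forall^\infty\forall,\ \exists^\infty\forall,\ \forall\forall^\infty\forall,\ \forall\forall^\infty$. (3) For every $\Pi_3$ quantifier-pattern $\bar{\mathsf Q}$ there is $\bar{\mathsf P}$ among the following $7$ patterns with $\langle\bar{\mathsf Q}\rangle\equiv_{\sf dm}\langle\bar{\mathsf P}\rangle$: $\forall\exists\forall,\ \exists^\infty\exists\forall,\ \exists^\infty\forall^\infty\forall,\ \exists^\infty\forall^\infty,\ \exists^\infty\forall,\ \forall\forall^\infty\forall,\ \forall\forall^\infty$.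
   Context: Quantifiers range over $\omega$. $\exists^\infty n\,\varphi(n)$ means $\forall m\exists n\ge m\,\varphi(n)$ and $\forall^\infty n\,\varphi(n)$ means $\exists m\forall n\ge m\,\varphi(n)$. A quantifier-pattern is a finite nonempty string $\bar{\mathsf Q}=\mathsf Q_0\dots\mathsf Q_\ell$ over $\{\exists,\forall,\exists^\infty,\forall^\infty\}$. Hierarchy of patterns, defined inductively: $\exists,\forall,\exists^\infty,\forall^\infty$ are $\Sigma_1,\Pi_1,\Pi_2,\Sigma_2$ respectively. If $\bar{\mathsf Q}$ is $\Sigma_n$, then $\exists\bar{\mathsf Q},\forall\bar{\mathsf Q},\exists^\infty\bar{\mathsf Q},\forall^\infty\bar{\mathsf Q}$ are $\Sigma_n,\Pi_{n+1},\Pi_{n+1},\Sigma_{n+2}$ respectively. If $\bar{\mathsf Q}$ is $\Pi_n$, then $\exists\bar{\mathsf Q},\forall\bar{\mathsf Q},\exists^\infty\bar{\mathsf Q},\forall^\infty\bar{\mathsf Q}$ are $\Sigma_{n+1},\Pi_n,\Pi_{n+2},\Sigma_{n+1}$ respectively. A $\bar{\mathsf Q}$-formula is $\varphi(\bar x)\equiv\mathsf Q_0n_0\dots\mathsf Q_\ell n_\ell\,\theta(n_0,\dots,n_\ell,\bar x)$ with $\theta$ a bounded formula (all quantifiers bounded; no further parameters). The instance $\bar x$ is a tuple of natural numbers and/or total computable functions (computable elements of $\omega^\omega$). Spaces such as $\omega\times\omega^\omega$, $(\omega^\omega)^\omega$, $\omega^{\omega\times\omega}$ are identified with $\omega^\omega$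 by computable pairing. Witnesses: for $\alpha\in\omega^\omega$, define $\alpha\Vdash\varphi(\bar x)$ ("$\alpha$ is a witness for $\varphi(\bar x)$") by: $\alpha\Vdash\theta(\bar x)$ iff $\alpha=\bar x$ and $\theta(\bar x)$ holds, for bounded $\theta$; $\langle t,\alpha\rangle\Vdash\exists n\varphi(n,\bar x)$ iff $\alpha\Vdash\varphi(t,\bar x)$; $\alpha\Vdash\forall n\varphi(n,\bar x)$ iff $\alpha(n)\Vdash\varphi(n,\bar x)$ for all $n$; $\langle t,\alpha\rangle\Vdash\forall^\infty n\varphi(n,\bar x)$ iff $\alpha(n)\Vdash\varphi(n,\bar x)$ for all $n\ge t$; $\alpha\Vdash\exists^\infty n\varphi(n,\bar x)$ iff for all $n$, writing $\alpha(n)=\langle k,\beta\rangle$, we have $k\ge n$ and $\beta\Vdash\varphi(k,\bar x)$. Reducibility: $\varphi\le_{\sf m}\psi$ if there are computable functions $\eta,r_-,r_+$ (type-two computable functionals, possibly partial but defined wherever required) such that for every instance $\bar x$: $\varphi(\bar x)$ is true iff $\psi(\eta(\bar x))$ is true; $\alpha\Vdash\varphi(\bar x)$ implies $r_-(\alpha,\bar x)\Vdash\psi(\eta(\bar x))$; $\alpha\Vdash\psi(\eta(\bar x))$ implies $r_+(\alpha,\bar x)\Vdash\varphi(\bar x)$. The witness $\alpha$ is an arbitrary element of $\omega^\omega$. Duals: $\exists,\forall$ are dual to each other and so are $\exists^\infty,\forall^\infty$. The dual $\varphi^{\sf d}$ of $\mathsf Q_0n_0\dots\mathsf Q_\ell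 n_\ell\,\theta$ is $\mathsf Q_0^{\sf d}n_0\dots\mathsf Q_\ell^{\sf d}n_\ell\,\neg\theta$. $\varphi\le_{\sf dm}\psi$ if $\varphi\le_{\sf m}\psi$ and $\varphi^{\sf d}\le_{\sf m}\psi^{\sf d}$ via a common $\eta$ (the realizers $r_\pm$ may differ). $\equiv_{\sf m},\equiv_{\sf dm}$ denote the induced equivalences. $\langle\bar{\mathsf Q}\rangle$ denotes a fixed $\bar{\mathsf Q}$-formula to which every $\bar{\mathsf Q}$-formula is $\le_{\sf dm}$-reducible; concretely $\langle\bar{\mathsf Q}\rangle(x)\equiv\mathsf Q_0n_0\dots\mathsf Q_\ell n_\ell.\ x(n_0,\dots,n_\ell)=0$ (the choice does not matter up to $\equiv_{\sf dm}$). -}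

module Defs where

open import Data.Fin using (Fin)
open import Data.List using (List; []; _∷_; length)
open import Data.Nat using (ℕ; zero; suc; _+_; _≥_; _<_)
open import Data.Product using (Σ; ∃-syntax; _×_)
open import Data.Vec using (Vec; []; _∷_; fromList; lookup; map)
open import Data.Vec.Relation.Binary.Pointwise.Inductive using (Pointwise)
open import Function.Bundles using (_⇔_)
open import Relation.Binary.PropositionalEquality using (_≡_; _≗_)
open import Relation.Nullary using (¬_)

Baire : Set
Baire = ℕ → ℕ

triangle : ℕ → ℕ
triangle zero    = zero
triangle (suc n) = suc n + triangle n

-- The Cantor bijection ℕ × ℕ → ℕ.
pair : ℕ → ℕ → ℕ
pair m n = triangle (m + n) + n

-- The bijections ℕᵏ → ℕ for k ≥ 1 (k = 1 being the identity); the value at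
-- k = 0 is a dummy.
tuple : ∀ {k} → Vec ℕ k → ℕ
tuple []           = 0
tuple (n ∷ [])     = n
tuple (n ∷ m ∷ ns) = pair n (tuple (m ∷ ns))

-- α ∈ ω^ω is identified with ⟨ α 0 , tail α ⟩ ∈ ω × ω^ω, and with the
-- sequence (row α n)ₙ ∈ (ω^ω)^ω.
tail : Baire → Baire
tail α n = α (suc n)

row : Baire → ℕ → Baire
row α n m = α (pair n m)

-- ⟨ n₀ , … , nₖ₋₁ , x ⟩ ∈ ωᵏ × ω^ω, coded as an element of ω^ω.
_▹_ : ∀ {k} → Vec ℕ k → Baire → Baire
([]       ▹ x) i       = x i
((n ∷ ns) ▹ x) zero    = n
((n ∷ ns) ▹ x) (suc i) = (ns ▹ x) i

-- Code o k : codes of k-ary partial functions, recursive in o oracles.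
data Code (o : ℕ) : ℕ → Set where
  zer   : Code o 0
  succ  : Code o 1
  proj  : ∀ {k} → Fin k → Code o k
  query : Fin o → Code o 1
  comp  : ∀ {j k} → Code o j → Vec (Code o k) j → Code o k
  prec  : ∀ {k} → Code o k → Code o (2 + k) → Code o (suc k)
  mini  : ∀ {k} → Code o (suc k) → Code o k

infix 4 _⊢_[_]↓_

-- σ ⊢ c [ ns ]↓ r : on input ns with oracles σ, the code c halts with value r.
data _⊢_[_]↓_ {o} (σ : Vec Baire o) : ∀ {k} → Code o k → Vec ℕ k → ℕ → Set where
  zer↓   : σ ⊢ zer [ [] ]↓ 0
  succ↓  : ∀ {n} → σ ⊢ succ [ n ∷ [] ]↓ suc n
  proj↓  : ∀ {k} {i : Fin k} {ns} → σ ⊢ proj i [ ns ]↓ lookup ns i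
  query↓ : ∀ {i n} → σ ⊢ query i [ n ∷ [] ]↓ lookup σ i n
  comp↓  : ∀ {j k} {f : Code o j} {gs : Vec (Code o k) j} {ns ms r} →
           Pointwise (λ g m → σ ⊢ g [ ns ]↓ m) gs ms →
           σ ⊢ f [ ms ]↓ r →
           σ ⊢ comp f gs [ ns ]↓ r
  prec↓0 : ∀ {k} {f : Code o k} {g ns r} →
           σ ⊢ f [ ns ]↓ r →
           σ ⊢ prec f g [ 0 ∷ ns ]↓ r
  prec↓s : ∀ {k} {f : Code o k} {g ns n r s} →
           σ ⊢ prec f g [ n ∷ ns ]↓ r →
           σ ⊢ g [ n ∷ r ∷ ns ]↓ s →
           σ ⊢ prec f g [ suc n ∷ ns ]↓ s
  mini↓  : ∀ {k} {f : Code o (suc k)} {ns n} →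
           (∀ m → m < n → ∃[ r ] σ ⊢ f [ m ∷ ns ]↓ suc r) →
           σ ⊢ f [ n ∷ ns ]↓ 0 →
           σ ⊢ mini f [ ns ]↓ n

-- Codes of type-two functionals (ω^ω)^o ⇀ ω^ω: the arguments are the oracles.
Functional : ℕ → Set
Functional o = Code o 1

-- F is defined at σ, with value β.
_⟨_⟩↦_ : ∀ {o} → Functional o → Vec Baire o → Baire → Set
F ⟨ σ ⟩↦ β = ∀ n → σ ⊢ F [ n ∷ [] ]↓ β n

Computable : Baire → Set
Computable x = Σ (Functional 0) λ F → F ⟨ [] ⟩↦ x

data Quantifier : Set where
  ∃₀ ∀₀ ∃∞ ∀∞ : Quantifier

-- The empty string is admitted for the sake of recursion; IsΣ and IsΠ hold of
-- nonempty strings only.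
Pattern : Set
Pattern = List Quantifier

mutual
  data IsΣ : ℕ → Pattern → Set where
    [∃]  : IsΣ 1 (∃₀ ∷ [])
    [∀∞] : IsΣ 2 (∀∞ ∷ [])
    ∃Σ   : ∀ {n Q} → IsΣ n Q → IsΣ n       (∃₀ ∷ Q)
    ∀∞Σ  : ∀ {n Q} → IsΣ n Q → IsΣ (2 + n) (∀∞ ∷ Q)
    ∃Π   : ∀ {n Q} → IsΠ n Q → IsΣ (1 + n) (∃₀ ∷ Q)
    ∀∞Π  : ∀ {n Q} → IsΠ n Q → IsΣ (1 + n) (∀∞ ∷ Q)

  data IsΠ : ℕ → Pattern → Set where
    [∀]  : IsΠ 1 (∀₀ ∷ [])
    [∃∞] : IsΠ 2 (∃∞ ∷ [])
    ∀Σ   : ∀ {n Q} → IsΣ n Q → IsΠ (1 + n) (∀₀ ∷ Q)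
    ∃∞Σ  : ∀ {n Q} → IsΣ n Q → IsΠ (1 + n) (∃∞ ∷ Q)
    ∀Π   : ∀ {n Q} → IsΠ n Q → IsΠ n       (∀₀ ∷ Q)
    ∃∞Π  : ∀ {n Q} → IsΠ n Q → IsΠ (2 + n) (∃∞ ∷ Q)

dualQ : Quantifier → Quantifier
dualQ ∃₀ = ∀₀
dualQ ∀₀ = ∃₀
dualQ ∃∞ = ∀∞
dualQ ∀∞ = ∃∞

-- φ(x) ≡ Q₀n₀ … Qₗnₗ θ(n₀,…,nₗ,x), with θ the matrix.  No syntax of bounded
-- formulas is imposed on θ: truth, witnesses and reducibility make sense for
-- any θ, and they are only applied to the formulas ⟨ Q ⟩ and their duals.
-- Tuple instances are coded as a single x ∈ ω^ω.
record Formula : Set₁ where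
  field
    {arity} : ℕ
    prefix  : Vec Quantifier arity
    matrix  : Vec ℕ arity → Baire → Set

open Formula

⟨_⟩ : Pattern → Formula
⟨ Q ⟩ = record { prefix = fromList Q ; matrix = λ ns x → x (tuple ns) ≡ 0 }

dual : Formula → Formula
dual φ = record
  { prefix = map dualQ (prefix φ)
  ; matrix = λ ns x → ¬ matrix φ ns x
  }

Quantify : Quantifier → (ℕ → Set) → Set
Quantify ∃₀ P = ∃[ n ] P n
Quantify ∀₀ P = ∀ n → P n
Quantify ∃∞ P = ∀ m → ∃[ n ] (n ≥ m × P n)
Quantify ∀∞ P = ∃[ m ] (∀ n → n ≥ m → P n)

Holds : ∀ {k} → Vec Quantifier k → (Vec ℕ k → Set) → Set
Holds []      P = P []
Holds (q ∷ Q) P = Quantify q λ n → Holds Q λ ns → P (n ∷ ns)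

IsTrue : Formula → Baire → Set
IsTrue φ x = Holds (prefix φ) λ ns → matrix φ ns x

-- W ns β says that β is a witness for the matrix at ns.
Witnesses : ∀ {k} → Vec Quantifier k → (Vec ℕ k → Baire → Set) → Baire → Set
Witnesses []       W α = W [] α
Witnesses (∃₀ ∷ Q) W α = Witnesses Q (λ ns → W (α 0 ∷ ns)) (tail α)
Witnesses (∀₀ ∷ Q) W α = ∀ n → Witnesses Q (λ ns → W (n ∷ ns)) (row α n)
Witnesses (∀∞ ∷ Q) W α =
  ∀ n → n ≥ α 0 → Witnesses Q (λ ns → W (n ∷ ns)) (row (tail α) n)
Witnesses (∃∞ ∷ Q) W α = ∀ n →
  let k = row α n 0
      β = tail (row α n)
  in  k ≥ n × Witnesses Q (λ ns → W (k ∷ ns)) β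

-- At the matrix, the only witness is the instance (n₀,…,nₗ,x) itself; equality
-- in ω^ω is pointwise.
_⊩_at_ : Baire → Formula → Baire → Set
α ⊩ φ at x = Witnesses (prefix φ) (λ ns β → β ≗ (ns ▹ x) × matrix φ ns x) α

infix 4 _≤ₘ_via_ _≤ₘ_ _≤dm_ _≡ₘ_ _≡dm_

-- The instances x are the computable elements of ω^ω; the witnesses α are
-- arbitrary.  The functionals need only be defined where a value is required.
_≤ₘ_via_ : Formula → Formula → Functional 1 → Set
φ ≤ₘ ψ via η =
  Σ (Functional 2) λ r₋ → Σ (Functional 2) λ r₊ →
    ∀ x → Computable x →
      Σ Baire λ y → (η ⟨ x ∷ [] ⟩↦ y) ×
        (IsTrue φ x ⇔ IsTrue ψ y) ×
        (∀ α → α ⊩ φ at x → Σ Baire λ β → (r₋ ⟨ α ∷ x ∷ [] ⟩↦ β) × β ⊩ ψ at y) ×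
        (∀ α → α ⊩ ψ at y → Σ Baire λ β → (r₊ ⟨ α ∷ x ∷ [] ⟩↦ β) × β ⊩ φ at x)

_≤ₘ_ : Formula → Formula → Set
φ ≤ₘ ψ = Σ (Functional 1) λ η → φ ≤ₘ ψ via η

_≤dm_ : Formula → Formula → Set
φ ≤dm ψ = Σ (Functional 1) λ η → (φ ≤ₘ ψ via η) × (dual φ ≤ₘ dual ψ via η)

_≡ₘ_ : Formula → Formula → Set
φ ≡ₘ ψ = φ ≤ₘ ψ × ψ ≤ₘ φ

_≡dm_ : Formula → Formula → Set
φ ≡dm ψ = φ ≤dm ψ × ψ ≤dm φ

{-# OPTIONS --safe #-}

-- Up to ≤dm a pattern can be simplified by four moves that come in dual pairs with
-- a common instance map: dummy quantifiers may be added, ∀∀ and ∃∃ contracted,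
-- ∀∞n θ(n) rewritten as ∃t∀n θ(t+n) (dually ∃∞ as ∀∃), and ∀n θ(n) rewritten as
-- ∀∞n θ(fst n), where every value recurs infinitely often (dually ∃ as ∃∞).  By
-- congruence these reduce Π₃ patterns to the seven representatives.  Up to ≤ₘ three
-- more reductions are available.  ∀∃ reduces to ∃∞: a counter steps through the
-- requirements n, and the stages at which it moves are counted.  ∀n∃k reduces to
-- ∃∞n∃s∀i, where s codes solutions for all i ≤ n.  ∃∞n∀∞k reduces to ∃∞∀: a pair
-- ⟨n,t⟩ is counted if t is the least threshold for n.  The Σ₃ patterns are the duals
-- of the Π₃ patterns.  Truth of a formula is existence of a witness, so the
-- equivalence of truth values comes for free with the witness maps.
module Submission where

open import Defs
open import Data.Fin using (Fin; zero; suc; toℕ; fromℕ<; _↑ˡ_; _↑ʳ_)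
open import Data.Fin.Properties using (pigeonhole; toℕ<n; fromℕ<-injective)
open import Data.List using (List; []; _∷_; length)
import Data.List as List
open import Data.List.Membership.Propositional using (_∈_)
open import Data.List.Membership.Propositional.Properties using (∈-map⁺)
open import Data.List.Relation.Unary.Any using (here; there)
open import Data.Nat
open import Data.Nat.Properties
open import Data.Product using (Σ; _×_; _,_; proj₁; proj₂; ∃-syntax; swap)
open import Data.Sum using (_⊎_; inj₁; inj₂)
open import Data.Vec using (Vec; []; _∷_; _++_; lookup; map; tabulate; fromList)
open import Data.Vec.Properties using (lookup-++ˡ; lookup-++ʳ)
open import Data.Vec.Relation.Binary.Pointwise.Inductive using (Pointwise; []; _∷_; ++⁺)
open import Function using (_∘_; mk⇔)
open import Relation.Binary.PropositionalEquality hiding ([_])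
open import Relation.Nullary using (¬_; Dec; yes; no; contradiction)
open import Relation.Nullary.Decidable using (dec-yes-irr)

-- Substituting codes for oracles.

mutual
  substitute : ∀ {o o′ j k} → Vec (Code o (suc j)) o′ → Code o′ k → Code o (k + j)
  substitute ds zer         = comp zer []
  substitute ds succ        = comp succ (proj zero ∷ [])
  substitute ds (proj i)    = proj (i ↑ˡ _)
  substitute ds (query i)   = lookup ds i
  substitute ds (comp f gs) =
    -- The codes in `ds` read `j` parameters kept at the end of the argument list, so these are
    -- handed on to `f` as well.
    comp (substitute ds f) (substitutes ds gs ++ tabulate (proj ∘ (_ ↑ʳ_)))
  substitute ds (prec f g)  = prec (substitute ds f) (substitute ds g)
  substitute ds (mini f)    = mini (substitute ds f)

  substitutes : ∀ {o o′ i j k} → Vec (Code o (suc j)) o′ →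
                Vec (Code o′ k) i → Vec (Code o (k + j)) i
  substitutes ds []       = []
  substitutes ds (c ∷ cs) = substitute ds c ∷ substitutes ds cs

projections↓ : ∀ {o i k} {τ : Vec Baire o} {ms : Vec ℕ k} (f : Fin i → Fin k) (ps : Vec ℕ i) →
               (∀ l → lookup ms (f l) ≡ lookup ps l) →
               Pointwise (λ g m → τ ⊢ g [ ms ]↓ m) (tabulate (proj ∘ f)) ps
projections↓ f []       eq = []
projections↓ f (p ∷ ps) eq =
  subst (_ ⊢ _ [ _ ]↓_) (eq zero) proj↓ ∷ projections↓ (f ∘ suc) ps (eq ∘ suc)

module _ {o o′ j} {σ : Vec Baire o′} {τ : Vec Baire o} {ps : Vec ℕ j}
         {ds : Vec (Code o (suc j)) o′}
         (oracles : ∀ i n → τ ⊢ lookup ds i [ n ∷ ps ]↓ lookup σ i n) where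
  mutual
    substitute↓ : ∀ {k} {c : Code o′ k} {ns r} →
                  σ ⊢ c [ ns ]↓ r → τ ⊢ substitute ds c [ ns ++ ps ]↓ r
    substitute↓ zer↓       = comp↓ [] zer↓
    substitute↓ succ↓      = comp↓ (proj↓ ∷ []) succ↓
    substitute↓ {ns = ns} (proj↓ {i = i}) =
      subst (_ ⊢ _ [ _ ]↓_) (lookup-++ˡ ns ps i) proj↓
    substitute↓ query↓     = oracles _ _
    substitute↓ {ns = ns} (comp↓ gs f) =
      comp↓ (++⁺ (substitutes↓ gs) (projections↓ _ ps (lookup-++ʳ ns ps))) (substitute↓ f)
    substitute↓ (prec↓0 f) = prec↓0 (substitute↓ f)
    substitute↓ (prec↓s p g) = prec↓s (substitute↓ p) (substitute↓ g)
    substitute↓ (mini↓ below f) =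
      mini↓ (λ m m<n → proj₁ (below m m<n) , substitute↓ (proj₂ (below m m<n))) (substitute↓ f)

    substitutes↓ : ∀ {i k} {cs : Vec (Code o′ k) i} {ns ms} →
                   Pointwise (λ g m → σ ⊢ g [ ns ]↓ m) cs ms →
                   Pointwise (λ g m → τ ⊢ g [ ns ++ ps ]↓ m) (substitutes ds cs) ms
    substitutes↓ []       = []
    substitutes↓ (d ∷ ds) = substitute↓ d ∷ substitutes↓ ds

-- Total recursive operations bundled with their codes.

record Op (o k : ℕ) : Set where
  constructor op
  field
    app  : Vec Baire o → Vec ℕ k → ℕ
    code : Code o k
    run  : ∀ σ ns → σ ⊢ code [ ns ]↓ app σ ns

open Op

apps : ∀ {o k j} → Vec (Op o k) j → Vec Baire o → Vec ℕ k → Vec ℕ j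
apps []       σ ns = []
apps (t ∷ ts) σ ns = app t σ ns ∷ apps ts σ ns

runs : ∀ {o k j} (ts : Vec (Op o k) j) σ ns →
       Pointwise (λ g m → σ ⊢ g [ ns ]↓ m) (map code ts) (apps ts σ ns)
runs []       σ ns = []
runs (t ∷ ts) σ ns = run t σ ns ∷ runs ts σ ns

infixl 9 _·_
_·_ : ∀ {o} → Op o 1 → Vec Baire o → Baire
(t · σ) n = app t σ (n ∷ [])

var : ∀ {o k} → Fin k → Op o k
var i = op (λ σ ns → lookup ns i) (proj i) λ σ ns → proj↓

call : ∀ {o j k} → Op o j → Vec (Op o k) j → Op o k
call f ts = op (λ σ ns → app f σ (apps ts σ ns)) (comp (code f) (map code ts))
               λ σ ns → comp↓ (runs ts σ ns) (run f σ _)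

O : ∀ {o k} → Op o k
O = op (λ σ ns → 0) (comp zer []) λ σ ns → comp↓ [] zer↓

S : ∀ {o k} → Op o k → Op o k
S t = op (λ σ ns → suc (app t σ ns)) (comp succ (code t ∷ []))
         λ σ ns → comp↓ (run t σ ns ∷ []) succ↓

ask : ∀ {o k} → Fin o → Op o k → Op o k
ask i t = op (λ σ ns → lookup σ i (app t σ ns)) (comp (query i) (code t ∷ []))
             λ σ ns → comp↓ (run t σ ns ∷ []) query↓

natrec : ℕ → (ℕ → ℕ → ℕ) → ℕ → ℕ
natrec z s zero    = z
natrec z s (suc n) = s n (natrec z s n)

prim : ∀ {o k} → Op o k → Op o (2 + k) → Op o (suc k)
prim {o} {k} f g = op value (prec (code f) (code g)) halts
  where
  value : Vec Baire o → Vec ℕ (suc k) → ℕ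
  value σ (n ∷ ns) = natrec (app f σ ns) (λ i r → app g σ (i ∷ r ∷ ns)) n

  halts : ∀ σ ns → σ ⊢ prec (code f) (code g) [ ns ]↓ value σ ns
  halts σ (zero  ∷ ns) = prec↓0 (run f σ ns)
  halts σ (suc n ∷ ns) = prec↓s (halts σ (n ∷ ns)) (run g σ _)

-- The oracles of f are computed by gs, with the values of ps as parameters.
inst : ∀ {o o′ j k k′} → Op o′ k′ → Vec (Op o (suc j)) o′ →
       Vec (Op o k) j → Vec (Op o k) k′ → Op o k
inst {o} {o′} {j} f gs ps ts = op
  (λ σ ns → app f (oracles gs σ (apps ps σ ns)) (apps ts σ ns))
  (comp (substitute (map code gs) (code f)) (map code ts ++ map code ps))
  λ σ ns → comp↓ (++⁺ (runs ts σ ns) (runs ps σ ns))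
                 (substitute↓ (answers gs σ _) (run f _ _))
  where
  oracles : ∀ {i} → Vec (Op o (suc j)) i → Vec Baire o → Vec ℕ j → Vec Baire i
  oracles []       σ ms = []
  oracles (g ∷ gs) σ ms = (λ n → app g σ (n ∷ ms)) ∷ oracles gs σ ms

  answers : ∀ {i} (gs : Vec (Op o (suc j)) i) σ ms l n →
            σ ⊢ lookup (map code gs) l [ n ∷ ms ]↓ lookup (oracles gs σ ms) l n
  answers (g ∷ gs) σ ms zero    n = run g σ _
  answers (g ∷ gs) σ ms (suc l) n = answers gs σ ms l n

-- Keeps the code and exchanges only the value, so that `app` of the arithmetic below unfolds to the
-- usual operations instead of to `natrec`.
recast : ∀ {o k} (t : Op o k) (f : Vec Baire o → Vec ℕ k → ℕ) →
         (∀ σ ns → app t σ ns ≡ f σ ns) → Op o k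
recast t f eq = op f (code t) λ σ ns → subst (σ ⊢ code t [ ns ]↓_) (eq σ ns) (run t σ ns)

-- Arithmetic and the inverse of Cantor pairing.

pattern v0 = zero
pattern v1 = suc zero
pattern v2 = suc (suc zero)
pattern v3 = suc (suc (suc zero))

infixl 6 _⊕_ _⊖_
_⊕_ _⊖_ : ∀ {o k} → Op o k → Op o k → Op o k
_⊕_ {o} {k} t u = recast (call (prim (var v0) (S (var v1))) (t ∷ u ∷ []))
                 (λ σ ns → app t σ ns + app u σ ns) λ σ ns → eq (app t σ ns) _
  where
  eq : ∀ m n → natrec n (λ i r → suc r) m ≡ m + n
  eq zero    n = refl
  eq (suc m) n = cong suc (eq m n)

dec : ∀ {o k} → Op o k → Op o k
dec {o} t = recast (call (prim O (var v0)) (t ∷ []))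
                   (λ σ ns → pred (app t σ ns)) λ σ ns → eq (app t σ ns)
  where
  eq : ∀ m → natrec 0 (λ i r → i) m ≡ pred m
  eq zero    = refl
  eq (suc m) = refl

t ⊖ u = recast (call (prim (var v0) (dec (var v1))) (u ∷ t ∷ []))
               (λ σ ns → app t σ ns ∸ app u σ ns) λ σ ns → eq (app t σ ns) (app u σ ns)
  where
  eq : ∀ m n → natrec m (λ i r → pred r) n ≡ m ∸ n
  eq m zero    = refl
  eq m (suc n) = trans (cong pred (eq m n)) (pred[m∸n]≡m∸[1+n] m n)

ifz : ℕ → ℕ → ℕ → ℕ
ifz zero    a b = a
ifz (suc _) a b = b

ifZ : ∀ {o k} → Op o k → Op o k → Op o k → Op o k
ifZ c t u = recast (call (prim (var v0) (var v3)) (c ∷ t ∷ u ∷ []))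
                   (λ σ ns → ifz (app c σ ns) (app t σ ns) (app u σ ns)) λ σ ns → eq (app c σ ns)
  where
  eq : ∀ {a b} m → natrec a (λ i r → b) m ≡ ifz m a b
  eq zero    = refl
  eq (suc m) = refl

tri : ∀ {o k} → Op o k → Op o k
tri t = recast (call (prim O (S (var v0 ⊕ var v1))) (t ∷ [])) (λ σ ns → triangle (app t σ ns))
               λ σ ns → eq (app t σ ns)
  where
  eq : ∀ m → natrec 0 (λ i r → suc (i + r)) m ≡ triangle m
  eq zero    = refl
  eq (suc m) = cong (λ r → suc (m + r)) (eq m)

pr : ∀ {o k} → Op o k → Op o k → Op o k
pr t u = tri (t ⊕ u) ⊕ u

-- The largest d with triangle d ≤ p.
diagonal : ℕ → ℕ
diagonal = natrec 0 λ p d → ifz (triangle (suc d) ∸ suc p) (suc d) d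

fst snd : ℕ → ℕ
snd p = p ∸ triangle (diagonal p)
fst p = diagonal p ∸ snd p

diag π₁ π₂ : ∀ {o k} → Op o k → Op o k
diag t = call (prim O (ifZ (tri (S (var v1)) ⊖ S (var v0)) (S (var v1)) (var v1))) (t ∷ [])
π₂ t = call (var v0 ⊖ tri (diag (var v0))) (t ∷ [])
π₁ t = call (diag (var v0) ⊖ π₂ (var v0)) (t ∷ [])

-- Passing from `p` to `suc p` raises the diagonal by at most one, so one comparison per step
-- suffices.
triangle-diagonal : ∀ p → triangle (diagonal p) ≤ p × p < triangle (suc (diagonal p))
triangle-diagonal zero = z≤n , s≤s z≤n
triangle-diagonal (suc p) with triangle-diagonal p | triangle (suc (diagonal p)) ∸ suc p in eq
... | lo , hi | zero  = m∸n≡0⇒m≤n eq , s≤s (≤-trans hi (m≤n+m _ (suc (diagonal p))))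
... | lo , hi | suc _ =
  m≤n⇒m≤1+n lo , ≰⇒> λ le → 0≢1+n (trans (sym (m≤n⇒m∸n≡0 le)) eq)

triangle-mono : ∀ {m n} → m ≤ n → triangle m ≤ triangle n
triangle-mono z≤n       = z≤n
triangle-mono (s≤s m≤n) = s≤s (+-mono-≤ m≤n (triangle-mono m≤n))

diagonal-unique : ∀ {d p} → triangle d ≤ p → p < triangle (suc d) → diagonal p ≡ d
diagonal-unique {d} {p} lo hi = ≤-antisym
  (≮⇒≥ λ d<d′ → <⇒≱ hi (≤-trans (triangle-mono d<d′) (proj₁ (triangle-diagonal p))))
  (≮⇒≥ λ d′<d → <⇒≱ (proj₂ (triangle-diagonal p)) (≤-trans (triangle-mono d′<d) lo))

diagonal-pair : ∀ m n → diagonal (pair m n) ≡ m + n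
diagonal-pair m n = diagonal-unique (m≤m+n _ n)
  (s≤s (≤-trans (+-monoʳ-≤ (triangle (m + n)) (m≤n+m n m)) (≤-reflexive (+-comm _ (m + n)))))

snd-pair : ∀ m n → snd (pair m n) ≡ n
snd-pair m n = trans (cong (λ d → pair m n ∸ triangle d) (diagonal-pair m n))
                     (m+n∸m≡n (triangle (m + n)) n)

fst-pair : ∀ m n → fst (pair m n) ≡ m
fst-pair m n = trans (cong₂ _∸_ (diagonal-pair m n) (snd-pair m n)) (m+n∸n≡m m n)

m≤pair : ∀ m n → m ≤ pair m n
m≤pair m n = ≤-trans (m≤m+n m n) (≤-trans (n≤triangle (m + n)) (m≤m+n _ n))
  where
  n≤triangle : ∀ n → n ≤ triangle n
  n≤triangle zero    = z≤n
  n≤triangle (suc n) = m≤m+n (suc n) _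

n≤pair : ∀ m n → n ≤ pair m n
n≤pair m n = m≤n+m n _

-- Transport of witnesses and realizers below a quantifier.

-- Recoding rows through `pair` gives sequences that are only pointwise equal. Indices and
-- thresholds are themselves entries of the witness, so they too must be moved along `eq`.
Witnesses-cong : ∀ {k} (Q : Vec Quantifier k) {V V′ : Vec ℕ k → Baire → Set} →
                 (∀ ns {β γ} → β ≗ γ → V ns β → V′ ns γ) →
                 ∀ {α α′} → α ≗ α′ → Witnesses Q V α → Witnesses Q V′ α′
Witnesses-cong []       f eq w = f [] eq w
Witnesses-cong (∃₀ ∷ Q) {V′ = V′} f {α′ = α′} eq w =
  subst (λ n → Witnesses Q (λ ns → V′ (n ∷ ns)) (tail α′)) (eq 0)
        (Witnesses-cong Q (f ∘ (_ ∷_)) (eq ∘ suc) w)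
Witnesses-cong (∀₀ ∷ Q) f eq w n = Witnesses-cong Q (f ∘ (n ∷_)) (eq ∘ pair n) (w n)
Witnesses-cong (∀∞ ∷ Q) f eq w n n≥t =
  Witnesses-cong Q (f ∘ (n ∷_)) (λ m → eq (suc (pair n m))) (w n (subst (_≤ n) (sym (eq 0)) n≥t))
Witnesses-cong (∃∞ ∷ Q) {V′ = V′} f {α′ = α′} eq w n =
  subst (λ k → k ≥ n × Witnesses Q (λ ns → V′ (k ∷ ns)) (tail (row α′ n))) (eq (pair n 0))
        (proj₁ (w n) ,
         Witnesses-cong Q (f ∘ (_ ∷_)) (λ m → eq (pair n (suc m))) (proj₂ (w n)))

-- Copies the index or threshold that belongs to the quantifier and runs `r` on the rest. The second
-- oracle of `r` is computed by `u` from a position and the quantified number.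
lift : Quantifier → Op 2 2 → Op 2 1 → Op 2 1
lift ∃₀ u r =
  ifZ (var v0) (ask v0 O)
      (inst r (ask v0 (S (var v0)) ∷ u ∷ []) (ask v0 O ∷ []) (dec (var v0) ∷ []))
lift ∀₀ u r =
  inst r (ask v0 (pr (var v1) (var v0)) ∷ u ∷ []) (π₁ (var v0) ∷ []) (π₂ (var v0) ∷ [])
lift ∀∞ u r =
  ifZ (var v0) (ask v0 O) (inst r (ask v0 (S (pr (var v1) (var v0))) ∷ u ∷ [])
                                  (π₁ (dec (var v0)) ∷ []) (π₂ (dec (var v0)) ∷ []))
lift ∃∞ u r =
  ifZ (π₂ (var v0)) (ask v0 (pr (π₁ (var v0)) O))
      (inst r (ask v0 (pr (var v1) (S (var v0))) ∷
               -- Here the quantified number is the index stored in the row, not the number of the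
               -- row.
               call u (var v0 ∷ ask v0 (pr (var v1) O) ∷ []) ∷ [])
              (π₁ (var v0) ∷ []) (dec (π₂ (var v0)) ∷ []))

≗-∃∞ : ∀ {k} (Q : Vec Quantifier k) {V : Vec ℕ (suc k) → Baire → Set} →
       (∀ ns {β γ} → β ≗ γ → V ns β → V ns γ) → ∀ {n β γ} → β ≗ γ →
       β 0 ≥ n × Witnesses Q (λ ns → V (β 0 ∷ ns)) (tail β) →
       γ 0 ≥ n × Witnesses Q (λ ns → V (γ 0 ∷ ns)) (tail γ)
≗-∃∞ Q {V} resp {n} {γ = γ} eq (k≥n , w) =
  subst (λ k → k ≥ n × Witnesses Q (λ ns → V (k ∷ ns)) (tail γ)) (eq 0)
        (k≥n , Witnesses-cong Q (resp ∘ (_ ∷_)) (eq ∘ suc) w)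

-- Operations decode a position before acting on it; with `m` left free this identifies a row of
-- their output with the intended sequence.
unpair : ∀ {A : Set} (f : ℕ → ℕ → A) n m → f n m ≡ f (fst (pair n m)) (snd (pair n m))
unpair f n m = sym (cong₂ f (fst-pair n m) (snd-pair n m))

module _ {k l} {Q : Vec Quantifier k} {P : Vec Quantifier l}
         {V : Vec ℕ (suc k) → Baire → Set} {V′ : Vec ℕ (suc l) → Baire → Set}
         (resp : ∀ ns {β γ} → β ≗ γ → V′ ns β → V′ ns γ) (u : Op 2 2) (r : Op 2 1) (α x : Baire)
         (step : ∀ n β → Witnesses Q (λ ns → V (n ∷ ns)) β →
                 Witnesses P (λ ns → V′ (n ∷ ns))
                           (r · (β ∷ (λ m → app u (α ∷ x ∷ []) (m ∷ n ∷ [])) ∷ []))) where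

  lift-correct : ∀ q → Witnesses (q ∷ Q) V α → Witnesses (q ∷ P) V′ (lift q u r · (α ∷ x ∷ []))
  lift-correct ∃₀ w = step _ _ w
  lift-correct ∀₀ w n = Witnesses-cong P (resp ∘ (n ∷_))
    (unpair (λ n m → (r · (row α n ∷ (λ i → app u (α ∷ x ∷ []) (i ∷ n ∷ [])) ∷ [])) m) n)
    (step n _ (w n))
  lift-correct ∀∞ w n n≥t = Witnesses-cong P (resp ∘ (n ∷_))
    (unpair (λ n m → (r · (row (tail α) n ∷ (λ i → app u (α ∷ x ∷ []) (i ∷ n ∷ [])) ∷ [])) m) n)
    (step n _ (w n n≥t))
  lift-correct ∃∞ w n = ≗-∃∞ P {V′} resp {β = cons n}
    (unpair (λ n m → cons n m) n)
    (proj₁ (w n) , step _ _ (proj₂ (w n)))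
    where
    cons : ℕ → Baire
    cons n m = ifz m (row α n 0)
      ((r · (tail (row α n) ∷ (λ i → app u (α ∷ x ∷ []) (i ∷ row α n 0 ∷ [])) ∷ [])) (pred m))

-- Bare witnesses and reductions between prefixes.

nest : ∀ {k} → Vec ℕ k → ℕ
nest []       = 0
nest (n ∷ ns) = pair n (nest ns)

-- Witnesses without the copy of the instance at the leaves; with instances
-- coded by nest, Bare B (q ∷ Q) refers to Bare B Q at the rows of the instance.
Bare : ∀ {k} (B : ℕ → Set) → Vec Quantifier k → Baire → Baire → Set
Bare B Q α x = Witnesses Q (λ ns β → B (x (nest ns))) α

Bare-cong : ∀ {k B} (Q : Vec Quantifier k) {α α′ x x′} → α ≗ α′ → x ≗ x′ →
            Bare B Q α x → Bare B Q α′ x′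
Bare-cong {B = B} Q {x = x} eqα eqx = Witnesses-cong Q (λ ns _ → subst B (eqx (nest ns))) eqα

-- The instance map is an index, so that a pattern and its dual can be required to share it.
-- Equivalence of truth values is recovered from `to` and `from` by `choose` and `truth`.
record Reduction {k l} (B : ℕ → Set) (Q : Vec Quantifier k) (P : Vec Quantifier l)
                 (η : Op 1 1) : Set where
  field
    r₋ r₊ : Op 2 1
    to    : ∀ α x → Bare B Q α x → Bare B P (r₋ · (α ∷ x ∷ [])) (η · (x ∷ []))
    from  : ∀ α x → Bare B P α (η · (x ∷ [])) → Bare B Q (r₊ · (α ∷ x ∷ [])) x

open Reduction

idη : Op 1 1
idη = ask v0 (var v0)

reduction-refl : ∀ {k B} {Q : Vec Quantifier k} → Reduction B Q Q idη
reduction-refl = record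
  { r₋ = ask v0 (var v0) ; r₊ = ask v0 (var v0) ; to = λ α x w → w ; from = λ α x w → w }

_∘η_ : Op 1 1 → Op 1 1 → Op 1 1
η₂ ∘η η₁ = inst η₂ (η₁ ∷ []) [] (var v0 ∷ [])

reduction-trans : ∀ {k l m B η₁ η₂}
                  {Q : Vec Quantifier k} {P : Vec Quantifier l} {R : Vec Quantifier m} →
                  Reduction B Q P η₁ → Reduction B P R η₂ → Reduction B Q R (η₂ ∘η η₁)
reduction-trans {η₁ = η₁} f g = record
  { r₋   = inst (r₋ g) (r₋ f ∷ target ∷ []) [] (var v0 ∷ [])
  ; r₊   = inst (r₊ f) (inst (r₊ g) (ask v0 (var v0) ∷ target ∷ []) [] (var v0 ∷ [])
                        ∷ ask v1 (var v0) ∷ []) [] (var v0 ∷ [])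
  ; to   = λ α x w → to g _ _ (to f α x w)
  ; from = λ α x w → from f _ x (from g _ _ w)
  }
  where
  target : Op 2 1
  target = inst η₁ (ask v1 (var v0) ∷ []) [] (var v0 ∷ [])

rowsη : Op 1 1 → Op 1 1
rowsη η = inst η (ask v0 (pr (var v1) (var v0)) ∷ []) (π₁ (var v0) ∷ []) (π₂ (var v0) ∷ [])

-- Each value of the leading quantifier has its own instance, a row, and `η` acts on all rows
-- separately; hence the instance map is the same for every `q`.
reduction-cong : ∀ {k l B η} {Q : Vec Quantifier k} {P : Vec Quantifier l} q →
                 Reduction B Q P η → Reduction B (q ∷ Q) (q ∷ P) (rowsη η)
reduction-cong {B = B} {η} {Q} {P} q f = record
  { r₋   = lift q rowOp (r₋ f)
  ; r₊   = lift q rowOp (r₊ f)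
  ; to   = λ α x → lift-correct {Q = Q} {P} {λ ns _ → B (x (nest ns))} (λ ns _ b → b)
             rowOp (r₋ f) α x
             (λ n β w → Bare-cong {B = B} P (λ _ → refl) (rows x n) (to f β (row x n) w)) q
  ; from = λ α x → lift-correct {Q = P} {Q} {λ ns _ → B ((rowsη η · (x ∷ [])) (nest ns))}
             (λ ns _ b → b) rowOp (r₊ f) α x
             (λ n β w → from f β (row x n) (Bare-cong {B = B} P (λ _ → refl) (sym ∘ rows x n) w)) q
  }
  where
  rowOp : Op 2 2
  rowOp = ask v1 (pr (var v1) (var v0))

  rows : ∀ x n → η · (row x n ∷ []) ≗ row (rowsη η · (x ∷ [])) n
  rows x = unpair (λ n m → (η · (row x n ∷ [])) m)

-- Restoring the copies of the instance at the leaves.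

-- insert j ns z is ns ▹ z with the first j entries of z moved to the front: on the
-- way down to a leaf, z collects the path, and the ns are still to come.
insert : ∀ {k} → ℕ → Vec ℕ k → Baire → Baire
insert zero    ns z         = ns ▹ z
insert (suc j) ns z zero    = z 0
insert (suc j) ns z (suc i) = insert j ns (tail z) i

insert-[] : ∀ j z → z ≗ insert j [] z
insert-[] zero    z i       = refl
insert-[] (suc j) z zero    = refl
insert-[] (suc j) z (suc i) = insert-[] j (tail z) i

insertOp : ℕ → Op 2 2
insertOp zero    = ifZ (var v0) (var v1) (ask v1 (dec (var v0)))
insertOp (suc j) = ifZ (var v0) (ask v1 O)
  (inst (insertOp j) (ask v0 (var v0) ∷ ask v1 (S (var v0)) ∷ []) [] (dec (var v0) ∷ var v1 ∷ []))

insert-∷ : ∀ {k} j α z n (ns : Vec ℕ k) →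
           insert (suc j) ns (λ i → app (insertOp j) (α ∷ z ∷ []) (i ∷ n ∷ [])) ≗ insert j (n ∷ ns) z
insert-∷ zero    α z n ns zero    = refl
insert-∷ zero    α z n ns (suc i) = refl
insert-∷ (suc j) α z n ns zero    = refl
insert-∷ (suc j) α z n ns (suc i) = insert-∷ j α (tail z) n ns i

-- The second oracle collects the path: each quantifier passed inserts its number at depth `j`, and
-- at a leaf the oracle has become the copy required there.
fill : ∀ {k} → Vec Quantifier k → ℕ → Op 2 1
fill []      j = ask v1 (var v0)
fill (q ∷ Q) j = lift q (insertOp j) (fill Q (suc j))

fill-correct : ∀ {k} (Q : Vec Quantifier k) j {M : Vec ℕ k → Set} α z →
               Witnesses Q (λ ns β → M ns) α →
               Witnesses Q (λ ns β → β ≗ insert j ns z × M ns) (fill Q j · (α ∷ z ∷ []))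
fill-correct []      j α z w = insert-[] j z , w
fill-correct (q ∷ Q) j {M} α z =
  lift-correct {Q = Q} {Q} {λ ns _ → M ns}
    (λ ns eq (eq′ , m) → (λ i → trans (sym (eq i)) (eq′ i)) , m)
    (insertOp j) (fill Q (suc j)) α z
    (λ n β w → Witnesses-cong Q
      (λ ns eq (eq′ , m) →
        (λ i → trans (sym (eq i)) (trans (eq′ i) (insert-∷ j α z n ns i))) , m)
      (λ _ → refl) (fill-correct Q (suc j) β _ w)) q

-- tuple ends with the last component itself, nest with a dummy 0.
flat unflat : ℕ → Op 0 1
flat 0             = O
flat 1             = π₁ (var v0)
flat (suc (suc k)) = pr (π₁ (var v0)) (call (flat (suc k)) (π₂ (var v0) ∷ []))
unflat 0             = O
unflat 1             = pr (var v0) O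
unflat (suc (suc k)) = pr (π₁ (var v0)) (call (unflat (suc k)) (π₂ (var v0) ∷ []))

flat-nest : ∀ {k} (ns : Vec ℕ k) → (flat k · []) (nest ns) ≡ tuple ns
flat-nest []           = refl
flat-nest (n ∷ [])     = fst-pair n 0
flat-nest {suc (suc k)} (n ∷ m ∷ ns) = trans
  (sym (unpair (λ i p → pair i ((flat (suc k) · []) p)) n (nest (m ∷ ns))))
  (cong (pair n) (flat-nest (m ∷ ns)))

unflat-tuple : ∀ {k} (ns : Vec ℕ k) → (unflat k · []) (tuple ns) ≡ nest ns
unflat-tuple []           = refl
unflat-tuple (n ∷ [])     = refl
unflat-tuple {suc (suc k)} (n ∷ m ∷ ns) = trans
  (sym (unpair (λ i p → pair i ((unflat (suc k) · []) p)) n (tuple (m ∷ ns))))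
  (cong (pair n) (unflat-tuple (m ∷ ns)))

-- In type theory a proof of truth contains a witness.
choose : ∀ {k} (Q : Vec Quantifier k) {M : Vec ℕ k → Set} →
         Holds Q M → Σ Baire (Witnesses Q (λ ns β → M ns))
choose []       h = (λ _ → 0) , h
choose (∃₀ ∷ Q) (n , h) with choose Q h
... | α , w = (λ { zero → n ; (suc i) → α i }) , w
choose (∀₀ ∷ Q) h =
  (λ p → proj₁ (choose Q (h (fst p))) (snd p)) ,
  λ n → Witnesses-cong Q (λ ns _ m → m)
    (unpair (λ n → proj₁ (choose Q (h n))) n) (proj₂ (choose Q (h n)))
choose (∀∞ ∷ Q) {M} (t , h) = α , λ n n≥t →
    Witnesses-cong Q (λ ns _ m → m)
      (λ m → trans (cong (λ d → β n d m) (sym (dec-yes-irr (t ≤? n) ≤-irrelevant n≥t)))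
                   (unpair (λ n → β n (t ≤? n)) n m))
      (proj₂ (choose Q (h n n≥t)))
  where
  β : ∀ n → Dec (t ≤ n) → Baire
  β n (yes n≥t) = proj₁ (choose Q (h n n≥t))
  -- A filler: `h` offers nothing below the threshold.
  β n (no _)    = λ _ → 0

  α : Baire
  α zero    = t
  α (suc p) = β (fst p) (t ≤? fst p) (snd p)
choose (∃∞ ∷ Q) {M} h = (λ p → α (fst p) (snd p)) , λ n →
    ≗-∃∞ Q {λ ns _ → M ns} (λ ns _ m → m) (unpair α n)
      (proj₁ (proj₂ (h n)) , proj₂ (choose Q (proj₂ (proj₂ (h n)))))
  where
  α : ℕ → Baire
  α n zero    = proj₁ (h n)
  α n (suc i) = proj₁ (choose Q (proj₂ (proj₂ (h n)))) i

truth : ∀ {k} (Q : Vec Quantifier k) {M : Vec ℕ k → Set} α →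
        Witnesses Q (λ ns β → M ns) α → Holds Q M
truth []       α w = w
truth (∃₀ ∷ Q) α w = α 0 , truth Q _ w
truth (∀₀ ∷ Q) α w n = truth Q _ (w n)
truth (∀∞ ∷ Q) α w = α 0 , λ n n≥t → truth Q _ (w n n≥t)
truth (∃∞ ∷ Q) α w n = row α n 0 , proj₁ (w n) , truth Q _ (proj₂ (w n))

-- From reductions of bare witnesses to `≤ₘ`.

formula : ∀ {k} → (ℕ → Set) → Vec Quantifier k → Formula
formula B Q = record { prefix = Q ; matrix = λ ns x → B (x (tuple ns)) }

realη : ℕ → ℕ → Op 1 1 → Op 1 1
realη k l η = inst η (ask v0 (inst (flat k) [] [] (var v0 ∷ [])) ∷ []) []
                     (inst (unflat l) [] [] (var v0 ∷ []) ∷ [])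

-- Instances go from `tuple` codes to `nest` codes, through `η`, and back. Witnesses lose their leaf
-- copies, pass through the bare realizers, and regain copies of the other instance from `fill`.
reduction⇒≤ₘ : ∀ {k l B η} {Q : Vec Quantifier k} {P : Vec Quantifier l} → Reduction B Q P η →
               formula B Q ≤ₘ formula B P via code (realη k l η)
reduction⇒≤ₘ {k} {l} {B} {η} {Q} {P} f =
  code s₋ , code s₊ , λ x _ → y x , (λ n → run (realη k l η) _ _) ,
    mk⇔ (λ h → let α , w = choose Q h in truth P _ (down x (to f α _ (up x w))))
        (λ h → let α , w = choose P h in truth Q _ (up⁻ x (from f α (x̂ x) (down⁻ x w)))) ,
    (λ α w → s₋ · (α ∷ x ∷ []) , (λ n → run s₋ _ _) ,
      fill-correct P 0 (r₋ f · (α ∷ x̂ x ∷ [])) (y x) (down x (to f α (x̂ x) (up x (bare Q w))))) ,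
    (λ α w → s₊ · (α ∷ x ∷ []) , (λ n → run s₊ _ _) ,
      fill-correct Q 0 (r₊ f · (α ∷ x̂ x ∷ [])) x (up⁻ x (from f α (x̂ x) (down⁻ x (bare P w)))))
  where
  bare : ∀ {m} (R : Vec Quantifier m) {V : Vec ℕ m → Baire → Set} {M : Vec ℕ m → Set} {α} →
         Witnesses R (λ ns β → V ns β × M ns) α → Witnesses R (λ ns β → M ns) α
  bare R = Witnesses-cong R (λ ns _ → proj₂) (λ _ → refl)

  flatten : Op 2 1
  flatten = ask v1 (inst (flat k) [] [] (var v0 ∷ []))
  s₋ s₊ : Op 2 1
  s₋ = inst (fill P 0) (inst (r₋ f) (ask v0 (var v0) ∷ flatten ∷ []) [] (var v0 ∷ []) ∷
                        inst (realη k l η) (ask v1 (var v0) ∷ []) [] (var v0 ∷ []) ∷ []) [] (var v0 ∷ [])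
  s₊ = inst (fill Q 0) (inst (r₊ f) (ask v0 (var v0) ∷ flatten ∷ []) [] (var v0 ∷ []) ∷
                        ask v1 (var v0) ∷ []) [] (var v0 ∷ [])

  x̂ y : Baire → Baire
  x̂ x n = x ((flat k · []) n)
  y x = realη k l η · (x ∷ [])

  up : ∀ x {α} → Witnesses Q (λ ns β → B (x (tuple ns))) α → Bare B Q α (x̂ x)
  up x = Witnesses-cong Q (λ ns _ → subst (B ∘ x) (sym (flat-nest ns))) (λ _ → refl)

  up⁻ : ∀ x {α} → Bare B Q α (x̂ x) → Witnesses Q (λ ns β → B (x (tuple ns))) α
  up⁻ x = Witnesses-cong Q (λ ns _ → subst (B ∘ x) (flat-nest ns)) (λ _ → refl)

  down : ∀ x {α} → Bare B P α (η · (x̂ x ∷ [])) → Witnesses P (λ ns β → B (y x (tuple ns))) α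
  down x = Witnesses-cong P (λ ns _ → subst (B ∘ (η · (x̂ x ∷ []))) (sym (unflat-tuple ns)))
                            (λ _ → refl)

  down⁻ : ∀ x {α} → Witnesses P (λ ns β → B (y x (tuple ns))) α → Bare B P α (η · (x̂ x ∷ []))
  down⁻ x = Witnesses-cong P (λ ns _ → subst (B ∘ (η · (x̂ x ∷ []))) (unflat-tuple ns)) (λ _ → refl)

-- The elementary moves.

private
  a : ∀ {o k} → Op (suc o) k → Op (suc o) k
  a = ask v0
  p : ∀ {o k} → Op o (suc k)
  p = var v0

weakenη mergeη shiftη spreadη : Op 1 1
weakenη = a (π₂ p)
mergeη  = a (pr (π₁ (π₁ p)) (pr (π₂ (π₁ p)) (π₂ p)))
shiftη  = a (pr (π₁ p ⊕ π₁ (π₂ p)) (π₂ (π₂ p)))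
spreadη = a (pr (π₁ (π₁ p)) (π₂ p))

row-weaken : ∀ x n → x ≗ row (weakenη · (x ∷ [])) n
row-weaken x n m = cong x (sym (snd-pair n m))

row-merge : ∀ x n m → row (row x n) m ≗ row (mergeη · (x ∷ [])) (pair n m)
row-merge x n m i = trans (unpair (λ n m → x (pair n (pair m i))) n m)
  (unpair (λ q i → x (pair (fst q) (pair (snd q) i))) (pair n m) i)

row-shift : ∀ x t n → row x (t + n) ≗ row (row (shiftη · (x ∷ [])) t) n
row-shift x t n m = trans (unpair (λ n m → x (pair (t + n) m)) n m)
  (unpair (λ t q → x (pair (t + fst q) (snd q))) t (pair n m))

row-spread : ∀ x n → row x (fst n) ≗ row (spreadη · (x ∷ [])) n
row-spread x = unpair (λ n m → x (pair (fst n) m))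

module _ {k} {B : ℕ → Set} {R : Vec Quantifier k} where
  private

    _⟫_ : ∀ {α α′ x x′} → Bare B R α x → α ≗ α′ × x ≗ x′ → Bare B R α′ x′
    w ⟫ (eq , eq′) = Bare-cong {B = B} R eq eq′ w

    ≡∃∞ : ∀ x {n β γ} → β ≗ γ → β 0 ≥ n × Bare B R (tail β) (row x (β 0)) →
          γ 0 ≥ n × Bare B R (tail γ) (row x (γ 0))
    ≡∃∞ x = ≗-∃∞ R {λ ns _ → B (x (nest ns))} (λ ns _ b → b)

  -- All rows of the new instance are copies of the old one, so any index serves.
  weaken : ∀ q → Reduction B R (q ∷ R) weakenη
  weaken ∃₀ = record
    { r₋   = ifZ p O (a (dec p))
    ; r₊   = a (S p)
    ; to   = λ α x w → w ⟫ ((λ _ → refl) , row-weaken x 0)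
    ; from = λ α x w → w ⟫ ((λ _ → refl) , sym ∘ row-weaken x (α 0))
    }
  weaken ∀₀ = record
    { r₋   = a (π₂ p)
    ; r₊   = a (pr O p)
    ; to   = λ α x w n → w ⟫ (row-weaken α n , row-weaken x n)
    ; from = λ α x w → w 0 ⟫ ((λ _ → refl) , sym ∘ row-weaken x 0)
    }
  weaken ∀∞ = record
    { r₋   = ifZ p O (a (π₂ (dec p)))
    ; r₊   = a (S (pr (a O) p))
    ; to   = λ α x w n _ → w ⟫ (row-weaken α n , row-weaken x n)
    ; from = λ α x w → w (α 0) ≤-refl ⟫ ((λ _ → refl) , sym ∘ row-weaken x (α 0))
    }
  weaken ∃∞ = record
    { r₋   = ifZ (π₂ p) (π₁ p) (a (dec (π₂ p)))
    ; r₊   = a (pr O (S p))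
    ; to   = λ α x w n → ≡∃∞ (weakenη · (x ∷ [])) (unpair (λ n m → ifz m n (α (pred m))) n)
                           (≤-refl , w ⟫ ((λ _ → refl) , row-weaken x n))
    ; from = λ α x w → proj₂ (w 0) ⟫ ((λ _ → refl) , sym ∘ row-weaken x (row α 0 0))
    }

  merge-∀ : Reduction B (∀₀ ∷ ∀₀ ∷ R) (∀₀ ∷ R) mergeη
  merge-∀ = record
    { r₋   = a (pr (π₁ (π₁ p)) (pr (π₂ (π₁ p)) (π₂ p)))
    ; r₊   = a (pr (pr (π₁ p) (π₁ (π₂ p))) (π₂ (π₂ p)))
    ; to   = λ α x w n → w (fst n) (snd n) ⟫
        ( unpair (λ n m → α (pair (fst n) (pair (snd n) m))) n
        , unpair (λ n m → x (pair (fst n) (pair (snd n) m))) n )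
    ; from = λ α x w n m → w (pair n m) ⟫
        ( (λ i → trans (unpair (λ m i → α (pair (pair n m) i)) m i)
                       (unpair (λ n q → α (pair (pair n (fst q)) (snd q))) n (pair m i)))
        , sym ∘ row-merge x n m )
    }

  merge-∃ : Reduction B (∃₀ ∷ ∃₀ ∷ R) (∃₀ ∷ R) mergeη
  merge-∃ = record
    { r₋   = ifZ p (pr (a O) (a (S O))) (a (S p))
    ; r₊   = ifZ p (π₁ (a O)) (ifZ (dec p) (π₂ (a O)) (a (dec p)))
    ; to   = λ α x w → w ⟫ ((λ _ → refl) , row-merge x (α 0) (α 1))
    ; from = λ α x w → w ⟫
        ((λ _ → refl) , λ m → sym (unpair (λ n m → x (pair (fst n) (pair (snd n) m))) (α 0) m))
    }

  shift-∀∞ : Reduction B (∀∞ ∷ R) (∃₀ ∷ ∀₀ ∷ R) shiftη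
  shift-∀∞ = record
    { r₋   = ifZ p (a O) (a (S (pr (a O ⊕ π₁ (dec p)) (π₂ (dec p)))))
    ; r₊   = ifZ p (a O) (a (S (pr (π₁ (dec p) ⊖ a O) (π₂ (dec p)))))
    ; to   = λ α x w n → w (α 0 + n) (m≤m+n _ n) ⟫
        (unpair (λ n m → tail α (pair (α 0 + n) m)) n , row-shift x (α 0) n)
    ; from = λ α x w n n≥t → w (n ∸ α 0) ⟫
        ( unpair (λ n m → tail α (pair (n ∸ α 0) m)) n
        , λ m → trans (sym (row-shift x (α 0) (n ∸ α 0) m))
                      (cong (λ n → x (pair n m)) (m+[n∸m]≡n n≥t)) )
    }

  -- An index `k ≥ t` is stored as the difference `k ∸ t`, and `t` is added back on return.
  shift-∃∞ : Reduction B (∃∞ ∷ R) (∀₀ ∷ ∃₀ ∷ R) shiftη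
  shift-∃∞ = record
    { r₋   = ifZ (π₂ p) (a p ⊖ π₁ p) (a p)
    ; r₊   = ifZ (π₂ p) (π₁ p ⊕ a p) (a p)
    ; to   = λ α x w t → Bare-cong {B = B} (∃₀ ∷ R) {x = row (shiftη · (x ∷ [])) t}
        (λ m → unpair (λ t′ m′ → ifz m′ (α (pair t m) ∸ t′) (α (pair t m))) t m) (λ _ → refl)
        (proj₂ (w t) ⟫
          ( (λ _ → refl)
          , λ m → trans (cong (λ n → x (pair n m)) (sym (m+[n∸m]≡n (proj₁ (w t)))))
                        (row-shift x t _ m) ))
    ; from = λ α x w t → ≡∃∞ x
        (λ m → unpair (λ t′ m′ → ifz m′ (t′ + α (pair t m)) (α (pair t m))) t m)
        (m≤m+n t _ , w t ⟫ ((λ _ → refl) , sym ∘ row-shift x t _))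
    }

  -- For the way back, `pair n (α 0)` lies beyond the threshold `α 0` and still stands for `n`.
  spread-∀ : Reduction B (∀₀ ∷ R) (∀∞ ∷ R) spreadη
  spread-∀ = record
    { r₋   = ifZ p O (a (pr (π₁ (π₁ (dec p))) (π₂ (dec p))))
    ; r₊   = a (S (pr (pr (π₁ p) (a O)) (π₂ p)))
    ; to   = λ α x w n _ → w (fst n) ⟫ (row-spread α n , row-spread x n)
    ; from = λ α x w n → w (pair n (α 0)) (n≤pair n (α 0)) ⟫
        ( unpair (λ n m → tail α (pair (pair n (α 0)) m)) n
        , λ m → trans (sym (row-spread x (pair n (α 0)) m))
                      (cong (λ n → x (pair n m)) (fst-pair n (α 0))) )
    }

  -- Pairing the one index with `n` gives an index beyond `n`; conversely the answer to request 0
  -- already contains a valid index as first component.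
  spread-∃ : Reduction B (∃₀ ∷ R) (∃∞ ∷ R) spreadη
  spread-∃ = record
    { r₋   = ifZ (π₂ p) (pr (a O) (π₁ p)) (a (π₂ p))
    ; r₊   = ifZ p (π₁ (a (pr O O))) (a (pr O p))
    ; to   = λ α x w n → ≡∃∞ (spreadη · (x ∷ [])) (unpair (λ n m → ifz m (pair (α 0) n) (α m)) n)
        ( n≤pair (α 0) n
        , w ⟫ ((λ _ → refl) , λ m → trans (cong (λ n → x (pair n m)) (sym (fst-pair (α 0) n)))
                                          (row-spread x (pair (α 0) n) m)) )
    ; from = λ α x w → proj₂ (w 0) ⟫ ((λ _ → refl) , sym ∘ row-spread x (row α 0 0))
    }

infix 4 _≼_
-- Derivations are data, so that each can be interpreted for a pattern and its dual over one `η`,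
-- and can be dualised syntactically by `≼-dual`.
data _≼_ : Pattern → Pattern → Set where
  ≼-refl  : ∀ {Q} → Q ≼ Q
  ≼-trans : ∀ {Q P R} → Q ≼ P → P ≼ R → Q ≼ R
  ≼-cong  : ∀ q {Q P} → Q ≼ P → q ∷ Q ≼ q ∷ P
  ≼-weaken : ∀ q {R} → R ≼ q ∷ R
  ∀∀≼∀ : ∀ {R} → ∀₀ ∷ ∀₀ ∷ R ≼ ∀₀ ∷ R
  ∃∃≼∃ : ∀ {R} → ∃₀ ∷ ∃₀ ∷ R ≼ ∃₀ ∷ R
  ∀∞≼∃∀ : ∀ {R} → ∀∞ ∷ R ≼ ∃₀ ∷ ∀₀ ∷ R
  ∃∞≼∀∃ : ∀ {R} → ∃∞ ∷ R ≼ ∀₀ ∷ ∃₀ ∷ R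
  ∀≼∀∞ : ∀ {R} → ∀₀ ∷ R ≼ ∀∞ ∷ R
  ∃≼∃∞ : ∀ {R} → ∃₀ ∷ R ≼ ∃∞ ∷ R

Zero Nonzero : ℕ → Set
Zero n   = n ≡ 0
Nonzero n = ¬ n ≡ 0

≼-sound : ∀ {Q P} → Q ≼ P → Σ (Op 1 1) λ η →
          Reduction Zero (fromList Q) (fromList P) η ×
          Reduction Nonzero (map dualQ (fromList Q)) (map dualQ (fromList P)) η
≼-sound ≼-refl = idη , reduction-refl , reduction-refl
≼-sound (≼-trans d e) with ≼-sound d | ≼-sound e
... | η₁ , f , f′ | η₂ , g , g′ = η₂ ∘η η₁ , reduction-trans f g , reduction-trans f′ g′
≼-sound (≼-cong q d) with ≼-sound d
... | η , f , f′ = rowsη η , reduction-cong q f , reduction-cong (dualQ q) f′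
≼-sound (≼-weaken q) = weakenη , weaken q , weaken (dualQ q)
≼-sound ∀∀≼∀ = mergeη , merge-∀ , merge-∃
≼-sound ∃∃≼∃ = mergeη , merge-∃ , merge-∀
≼-sound ∀∞≼∃∀ = shiftη , shift-∀∞ , shift-∃∞
≼-sound ∃∞≼∀∃ = shiftη , shift-∃∞ , shift-∀∞
≼-sound ∀≼∀∞ = spreadη , spread-∀ , spread-∃
≼-sound ∃≼∃∞ = spreadη , spread-∃ , spread-∀

-- Besides `η`, `realη` depends only on the two lengths, which dualising preserves; so both halves
-- share the instance map.
≼⇒≤dm : ∀ {Q P} → Q ≼ P → ⟨ Q ⟩ ≤dm ⟨ P ⟩
≼⇒≤dm {Q} {P} d with ≼-sound d
... | η , f , f′ = code (realη (length Q) (length P) η) , reduction⇒≤ₘ f , reduction⇒≤ₘ f′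

-- Reducing ∀∃ to ∃∞: search and the requirement counter.

-- The least zero of f below n, and n if there is none.
least : (ℕ → ℕ) → ℕ → ℕ
least f = natrec 0 λ i r → ifz (f r) r (suc i)

leastOp : ∀ {o} → Op o 2 → Op o 2
leastOp f = prim O (ifZ (call f (var v1 ∷ var v2 ∷ [])) (var v1) (S (var v0)))

least≤ : ∀ (f : ℕ → ℕ) n → least f n ≤ n
least≤ f zero = z≤n
least≤ f (suc n) with f (least f n)
... | zero  = m≤n⇒m≤1+n (least≤ f n)
... | suc _ = ≤-refl

-- The default value is the bound itself, so a zero at the bound is found too; hence `m ≤ n` and not
-- `m < n`.
least-zero : ∀ (f : ℕ → ℕ) {m n} → m ≤ n → f m ≡ 0 → f (least f n) ≡ 0
least-zero f {n = zero} z≤n fm≡0 = fm≡0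
least-zero f {m} {suc n} m≤1+n fm≡0 with f (least f n) in eq
... | zero = eq
... | suc _ with m≤n⇒m<n∨m≡n m≤1+n
...   | inj₁ (s≤s m≤n) = contradiction (trans (sym eq) (least-zero f m≤n fm≡0)) λ ()
...   | inj₂ refl      = fm≡0

-- Feeding the successor of each answer back into a witness of `∃∞` yields a strictly increasing
-- sequence of valid indices.
climb : Baire → ℕ → ℕ
climb α = natrec (α (pair 0 0)) λ i r → α (pair (suc r) 0)

climbOp : Op 2 1
climbOp = prim (a (pr O O)) (a (pr (S (var v1)) O))

module _ {α : Baire} (large : ∀ n → row α n 0 ≥ n) where
  climb-< : ∀ i → climb α i < climb α (suc i)
  climb-< i = large _

  climb-mono : ∀ {i j} → i < j → climb α i < climb α j
  climb-mono {i} {suc j} (s≤s i≤j) with m≤n⇒m<n∨m≡n i≤j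
  ... | inj₁ i<j  = <-trans (climb-mono i<j) (climb-< j)
  ... | inj₂ refl = climb-< j

entry : Baire → ℕ → ℕ → ℕ
entry x n m = x (pair n (pair m 0))

entryOp : ∀ {o} → Fin o → Op o 2
entryOp i = ask i (pr (var v1) (pr (var v0) O))

-- met x n k is 0 iff the requirement n has a solution m ≤ k; the counter moves
-- on to the next requirement at the stages at which the current one is met.
met : Baire → ℕ → ℕ → ℕ
met x n k = entry x n (least (entry x n) k)

metOp : ∀ {o} → Fin o → Op o 2
metOp i = call (entryOp i) (leastOp (entryOp i) ∷ var v1 ∷ [])

counter : Baire → ℕ → ℕ
counter x = natrec 0 λ k r → ifz (met x r k) (suc r) r

counterOp : ∀ {o} → Fin o → Op o 1
counterOp i = prim O (ifZ (metOp i) (S (var v1)) (var v1))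

moves : Baire → ℕ → ℕ
moves x k = met x (counter x k) k

movesOp : ∀ {o} → Fin o → Op o 1
movesOp i = call (metOp i) (var v0 ∷ counterOp i ∷ [])

counter-suc : ∀ x k → moves x k ≡ 0 → counter x (suc k) ≡ suc (counter x k)
counter-suc x k eq = cong (λ c → ifz c (suc (counter x k)) (counter x k)) eq

counter-mono : ∀ x {k l} → k ≤ l → counter x k ≤ counter x l
counter-mono x {l = zero}  z≤n = z≤n
counter-mono x {k} {suc l} k≤1+l with m≤n⇒m<n∨m≡n k≤1+l
... | inj₂ refl = ≤-refl
... | inj₁ (s≤s k≤l) with moves x l
...   | zero  = m≤n⇒m≤1+n (counter-mono x k≤l)
...   | suc _ = counter-mono x k≤l

-- The counter leaves a requirement only when it is met, and a solution stays within all later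
-- bounds.
counter-met : ∀ x n k → n < counter x (suc k) → met x n k ≡ 0
counter-met x n k n<c with moves x k in eq
counter-met x n k       (s≤s n≤c) | zero with m≤n⇒m<n∨m≡n n≤c
counter-met x n k       (s≤s n≤c) | zero | inj₂ refl = eq
counter-met x n (suc k) (s≤s n≤c) | zero | inj₁ n<c =
  least-zero (entry x n) (m≤n⇒m≤1+n (least≤ (entry x n) k)) (counter-met x n k n<c)
counter-met x n (suc k) n<c       | suc _ =
  least-zero (entry x n) (m≤n⇒m≤1+n (least≤ (entry x n) k)) (counter-met x n k n<c)

counter-stuck : ∀ x n k → (∃[ i ] (i < k × moves x (n + i) ≡ 0)) ⊎ counter x (n + k) ≡ counter x n
counter-stuck x n zero = inj₂ (cong (counter x) (+-identityʳ n))
counter-stuck x n (suc k) with counter-stuck x n k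
... | inj₁ (i , i<k , eq) = inj₁ (i , m≤n⇒m≤1+n i<k , eq)
... | inj₂ stuck with moves x (n + k) in eq
...   | zero  = inj₁ (k , ≤-refl , eq)
...   | suc _ = inj₂ (trans (cong (counter x) (+-suc n k))
                  (trans (cong (λ c → ifz c (suc (counter x (n + k))) (counter x (n + k))) eq)
                         stuck))

counterη : Op 1 1
counterη = call (movesOp v0) (π₁ p ∷ [])

-- A solution `b` of the requirement current at stage `n` forces a move between `n` and `n + b`.
-- Conversely at least `n` moves precede the stage `climb α n`, and its own move takes the counter
-- beyond `n`; so `n` has a solution up to that stage, found by search.
∀∃≤∃∞ : Reduction Zero (∀₀ ∷ ∃₀ ∷ []) (∃∞ ∷ []) counterη
∀∃≤∃∞ = record { r₋ = s₋ ; r₊ = s₊ ; to = to′ ; from = from′ }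
  where
  s₋ s₊ : Op 2 1
  s₋ = π₁ p ⊕ call (leastOp (call (movesOp v1) (var v1 ⊕ var v0 ∷ [])))
                   (a (pr (call (counterOp v1) (π₁ p ∷ [])) O) ∷ π₁ p ∷ [])
  s₊ = call (leastOp (entryOp v1)) (call climbOp (π₁ p ∷ []) ∷ π₁ p ∷ [])

  to′ : ∀ α x → Bare Zero (∀₀ ∷ ∃₀ ∷ []) α x →
        Bare Zero (∃∞ ∷ []) (s₋ · (α ∷ x ∷ [])) (counterη · (x ∷ []))
  to′ α x w n = subst (λ k → k ≥ n × Zero ((counterη · (x ∷ [])) (pair k 0)))
    (unpair (λ n _ → k n) n 0)
    (m≤m+n n _ , trans (cong (moves x) (fst-pair (k n) 0)) move)
    where
    b : ℕ → ℕ
    b n = α (pair (counter x n) 0)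
    k : ℕ → ℕ
    k n = n + least (λ i → moves x (n + i)) (b n)
    move : moves x (k n) ≡ 0
    move with counter-stuck x n (b n)
    ... | inj₁ (i , i<b , eq) = least-zero (λ i → moves x (n + i)) (<⇒≤ i<b) eq
    -- Without a move before stage `n + b n` the requirement is unchanged, and its solution `b n` is
    -- within the bound of that stage.
    ... | inj₂ stuck = least-zero (λ i → moves x (n + i)) {n = b n} ≤-refl
      (trans (cong (λ c → met x c (n + b n)) stuck)
             (least-zero (entry x (counter x n)) (m≤n+m (b n) n) (w (counter x n))))

  from′ : ∀ α x → Bare Zero (∃∞ ∷ []) α (counterη · (x ∷ [])) →
          Bare Zero (∀₀ ∷ ∃₀ ∷ []) (s₊ · (α ∷ x ∷ [])) x
  from′ α x w n = subst (λ m → entry x n m ≡ 0)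
    (unpair (λ n _ → least (entry x n) (climb α n)) n 0)
    (counter-met x n (climb α n)
      (subst (n <_) (sym (counter-suc x (climb α n) (moving n))) (s≤s (count n))))
    where
    moving : ∀ i → moves x (climb α i) ≡ 0
    moving zero    = trans (cong (moves x) (sym (fst-pair (climb α 0) 0))) (proj₂ (w 0))
    moving (suc i) = trans (cong (moves x) (sym (fst-pair (climb α (suc i)) 0)))
                           (proj₂ (w (suc (climb α i))))
    count : ∀ i → i ≤ counter x (climb α i)
    count zero    = z≤n
    count (suc i) = ≤-trans
      (subst (suc i ≤_) (sym (counter-suc x (climb α i) (moving i))) (s≤s (count i)))
      (counter-mono x (climb-< {α} (proj₁ ∘ w) i))

-- Reducing ∀∃ to ∃∞∃∀ by coding finite histories.

nth : ℕ → ℕ → ℕ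
nth s i = fst (natrec s (λ _ → snd) i)

nthOp : ∀ {o} → Op o 2
nthOp = π₁ (prim p (π₂ (var v1)))

-- The code of the last c of the values f 0 , … , f N, where f i = α (pair i 0).
history : Baire → ℕ → ℕ → ℕ
history α N = natrec 0 λ c → pair (α (pair (N ∸ c) 0))

historyOp : Op 2 2
historyOp = prim O (pr (a (pr (var v2 ⊖ p) O)) (var v1))

-- Values are pushed from `f N` downwards, so the code lists them by increasing index, and dropping
-- `i` of the last `i + c` leaves the last `c`.
drop-history : ∀ α N i c → natrec (history α N (i + c)) (λ _ → snd) i ≡ history α N c
drop-history α N zero    c = refl
drop-history α N (suc i) c =
  trans (cong (λ d → snd (natrec (history α N d) (λ _ → snd) i)) (sym (+-suc i c)))
  (trans (cong snd (drop-history α N i (suc c))) (snd-pair (α (pair (N ∸ c) 0)) (history α N c)))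

nth-history : ∀ α {N i} → i ≤ N → nth (history α N (suc N)) i ≡ α (pair i 0)
nth-history α {N} {i} i≤N = begin
  nth (history α N (suc N)) i
    ≡⟨ cong (λ c → nth (history α N c) i)
            (trans (cong suc (sym (m+[n∸m]≡n i≤N))) (sym (+-suc i _))) ⟩
  nth (history α N (i + suc (N ∸ i))) i    ≡⟨ cong fst (drop-history α N i (suc (N ∸ i))) ⟩
  fst (history α N (suc (N ∸ i)))          ≡⟨ fst-pair _ (history α N (N ∸ i)) ⟩
  α (pair (N ∸ (N ∸ i)) 0)                 ≡⟨ cong (λ n → α (pair n 0)) (m∸[m∸n]≡n i≤N) ⟩
  α (pair i 0)                             ∎
  where open ≡-Reasoning

min : ℕ → ℕ → ℕ
min i n = i ∸ (i ∸ n)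

min≤ : ∀ i n → min i n ≤ n
min≤ i n = m≤n+o⇒m∸n≤o i (i ∸ n) (subst (i ≤_) (+-comm n _) (m≤n+m∸n i n))

min-≤ : ∀ {i n} → i ≤ n → min i n ≡ i
min-≤ {i} i≤n = cong (i ∸_) (m≤n⇒m∸n≡0 i≤n)

minOp : ∀ {o k} → Op o k → Op o k → Op o k
minOp t u = t ⊖ (t ⊖ u)

-- Clamping `i` to the index `k` makes the unbounded `∀ i` speak about the requirements up to `k`
-- only.
historyη : Op 1 1
historyη = a (pr j (pr (call nthOp (j ∷ π₁ (π₂ p) ∷ [])) (π₂ (π₂ (π₂ p)))))
  where
  j : Op 1 1
  j = minOp (π₁ (π₂ (π₂ p))) (π₁ p)

unpair³ : ∀ {A : Set} (f : ℕ → ℕ → ℕ → ℕ → A) k s i m →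
          let q = pair k (pair s (pair i m)) in
          f k s i m ≡ f (fst q) (fst (snd q)) (fst (snd (snd q))) (snd (snd (snd q)))
unpair³ f k s i m =
  trans (unpair (f k s) i m)
  (trans (unpair (λ s q → f k s (fst q) (snd q)) s (pair i m))
         (unpair (λ k q → f k (fst q) (fst (snd q)) (snd (snd q))) k (pair s (pair i m))))

-- Request `n` is answered by `n` itself with the solutions for `0` to `n`. Conversely an answer
-- `k ≥ n` leaves `n` unclamped, so its inner row `n` treats the requirement `n`.
∀∃≤∃∞∃∀ : ∀ {k B} {R : Vec Quantifier k} →
          Reduction B (∀₀ ∷ ∃₀ ∷ R) (∃∞ ∷ ∃₀ ∷ ∀₀ ∷ R) historyη
∀∃≤∃∞∃∀ {B = B} {R} = record { r₋ = s₋ ; r₊ = s₊ ; to = to′ ; from = from′ }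
  where
  s₋ s₊ : Op 2 1
  -- A row holds the index, then the history, then the rows of the inner `∀₀`; hence the two uses of
  -- `dec`.
  s₋ = ifZ (π₂ p) (π₁ p) (ifZ (dec (π₂ p)) (call historyOp (S (π₁ p) ∷ π₁ p ∷ []))
         (a (pr (minOp (π₁ (dec (dec (π₂ p)))) (π₁ p)) (S (π₂ (dec (dec (π₂ p))))))))
  s₊ = ifZ (π₂ p) (call nthOp (π₁ p ∷ a (pr (π₁ p) (S O)) ∷ []))
                  (a (pr (π₁ p) (S (S (pr (π₁ p) (dec (π₂ p)))))))

  target : Baire → ℕ → ℕ → ℕ → Baire
  target x k s i m = x (pair (min i k) (pair (nth s (min i k)) m))

  to′ : ∀ α x → Bare B (∀₀ ∷ ∃₀ ∷ R) α x →
        Bare B (∃∞ ∷ ∃₀ ∷ ∀₀ ∷ R) (s₋ · (α ∷ x ∷ [])) (historyη · (x ∷ []))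
  to′ α x w n = ≗-∃∞ (∃₀ ∷ ∀₀ ∷ R) {λ ns _ → B ((historyη · (x ∷ [])) (nest ns))} (λ ns _ b → b)
    {β = β n} (unpair β n)
    (≤-refl , λ i → Bare-cong {B = B} R
      (unpair (λ i m → α (pair (min i n) (suc m))) i)
      (λ m → trans (cong (λ k → x (pair (min i n) (pair k m))) (sym (nth-history α (min≤ i n))))
                   (unpair³ (target x) n (history α n (suc n)) i m))
      (w (min i n)))
    where
    β : ℕ → Baire
    β n m = ifz m n (ifz (pred m) (history α n (suc n))
              (α (pair (min (fst (pred (pred m))) n) (suc (snd (pred (pred m)))))))

  from′ : ∀ α x → Bare B (∃∞ ∷ ∃₀ ∷ ∀₀ ∷ R) α (historyη · (x ∷ [])) →
          Bare B (∀₀ ∷ ∃₀ ∷ R) (s₊ · (α ∷ x ∷ [])) x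
  from′ α x w n = Bare-cong {B = B} (∃₀ ∷ R) {x = row x n}
    (unpair (λ n m → ifz m (nth (α (pair n 1)) n) (α (pair n (suc (suc (pair n (pred m))))))) n)
    (λ _ → refl)
    (Bare-cong {B = B} R (λ _ → refl)
      (λ m → trans (sym (unpair³ (target x) (row α n 0) (row α n 1) n m))
                   (cong (λ j → x (pair j (pair (nth (row α n 1) j) m))) (min-≤ (proj₁ (w n)))))
      (proj₂ (w n) n))

-- Reducing ∃∞∀∞ to ∃∞∀ by least thresholds.

-- The start of the run of zeros of f that ends before t.
start : (ℕ → ℕ) → ℕ → ℕ
start f = natrec 0 λ s r → ifz (f s) r (suc s)

startOp : ∀ {o} → Op o 2 → Op o 2
startOp f = prim O (ifZ (call f (p ∷ var v2 ∷ [])) (var v1) (S p))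

start-zero : ∀ (f : ℕ → ℕ) t {k} → start f t ≤ k → k < t → f k ≡ 0
start-zero f (suc t) lo hi with f t in eq
... | suc _ = contradiction hi (≤⇒≯ lo)
... | zero with m≤n⇒m<n∨m≡n hi
...   | inj₁ (s≤s k<t) = start-zero f t lo k<t
...   | inj₂ refl      = eq

start-minimal : ∀ (f : ℕ → ℕ) t {s} → start f t ≡ suc s → f s ≢ 0
start-minimal f (suc t) eq with f t in eq′
... | zero  = start-minimal f t eq
start-minimal f (suc t) refl | suc _ = λ f≡0 → contradiction (trans (sym eq′) f≡0) λ ()

-- For all k, stage x n t k ≡ 0 iff t is the least threshold for n; in particular
-- distinct true pairs ⟨ n , t ⟩ have distinct n.
stage : Baire → ℕ → ℕ → ℕ → ℕ
stage x n t k = ifz t v (ifz (entry x n (pred t)) 1 v)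
  where
  v : ℕ
  v = entry x n (t + k)

thresholdη : Op 1 1
thresholdη = ifZ t v (ifZ (call (entryOp v0) (dec t ∷ n ∷ [])) (S O) v)
  where
  n t v : Op 1 1
  n = π₁ (π₁ p)
  t = π₂ (π₁ p)
  v = call (entryOp v0) (t ⊕ π₁ (π₂ p) ∷ n ∷ [])

threshold-stage : ∀ x c k → (thresholdη · (x ∷ [])) (pair c (pair k 0)) ≡ stage x (fst c) (snd c) k
threshold-stage x c k = sym (trans
  (unpair (λ k _ → stage x (fst c) (snd c) k) k 0)
  (unpair (λ c q → stage x (fst c) (snd c) (fst q)) c (pair k 0)))

stage-holds : ∀ x n t k → stage x n t k ≡ 0 → entry x n (t + k) ≡ 0
stage-holds x n zero    k eq = eq
stage-holds x n (suc t) k eq with entry x n t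
... | suc _ = eq

stage-minimal : ∀ x n t k → stage x n (suc t) k ≡ 0 → entry x n t ≢ 0
stage-minimal x n t k eq eq′ with entry x n t
stage-minimal x n t k () eq′ | zero

≤-entry : ∀ x n t → (∀ k → stage x n t k ≡ 0) → ∀ {k} → t ≤ k → entry x n k ≡ 0
≤-entry x n t h {k} t≤k = subst (λ k → entry x n k ≡ 0) (m+[n∸m]≡n t≤k)
                             (stage-holds x n t _ (h (k ∸ t)))

-- If `t < u`, the entry just before `u` vanishes because `t` is a threshold, against the minimality
-- of `u`.
stage-≤ : ∀ x n t u → (∀ k → stage x n t k ≡ 0) → (∀ k → stage x n u k ≡ 0) → u ≤ t
stage-≤ x n t u ht hu = ≮⇒≥ (absurd u hu)
  where
  absurd : ∀ u → (∀ k → stage x n u k ≡ 0) → ¬ t < u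
  absurd (suc u) hu (s≤s t≤u) = stage-minimal x n u 0 (hu 0) (≤-entry x n t ht t≤u)

stage-zero : ∀ x n t → (∀ {k} → t ≤ k → entry x n k ≡ 0) → (∀ {s} → t ≡ suc s → entry x n s ≢ 0) →
             ∀ k → stage x n t k ≡ 0
stage-zero x n zero    above below k = above {k} z≤n
stage-zero x n (suc t) above below k with entry x n t in eq
... | zero  = contradiction eq (below refl)
... | suc _ = above (m≤m+n (suc t) k)

pair-surjective : ∀ c → pair (fst c) (snd c) ≡ c
pair-surjective c = trans (cong (λ d → triangle d + snd c) (m∸n+n≡m snd≤diagonal))
                          (m+[n∸m]≡n (proj₁ (triangle-diagonal c)))
  where
  snd≤diagonal : snd c ≤ diagonal c
  snd≤diagonal = m≤n+o⇒m∸n≤o c (triangle (diagonal c))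
    (s≤s⁻¹ (subst (c <_) (cong suc (+-comm (diagonal c) _)) (proj₂ (triangle-diagonal c))))

-- By the pigeonhole principle `suc N` distinct values cannot all lie below `N`. The difference
-- `N ∸ f i` vanishes exactly when `f i` is large enough, which turns the choice into a search.
injective-large : ∀ (f : ℕ → ℕ) N → (∀ {i j} → i < j → f i ≢ f j) →
                  N ≤ f (least (λ i → N ∸ f i) N)
injective-large f N distinct = ≮⇒≥ λ f<N →
  let small : ∀ {i} → i ≤ N → f i < N
      small i≤N = ≰⇒> λ N≤f → <⇒≱ f<N
        (m∸n≡0⇒m≤n (least-zero (λ i → N ∸ f i) i≤N (m≤n⇒m∸n≡0 N≤f)))
      i , j , i<j , eq = pigeonhole ≤-refl λ (i : Fin (suc N)) → fromℕ< (small (s≤s⁻¹ (toℕ<n i)))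
  in distinct i<j (fromℕ<-injective _ _ _ _ eq)

-- Forwards, the given threshold is lowered to the least one, and the pair is at least its first
-- component. Backwards, a large pair may have a small first component, but distinct valid pairs
-- have distinct ones, so one of the first `suc n` pairs climbed has a first component of at least
-- `n`.
∃∞∀∞≤∃∞∀ : Reduction Zero (∃∞ ∷ ∀∞ ∷ []) (∃∞ ∷ ∀₀ ∷ []) thresholdη
∃∞∀∞≤∃∞∀ = record { r₋ = s₋ ; r₊ = s₊ ; to = to′ ; from = from′ }
  where
  s₋ s₊ : Op 2 1
  -- The pair is written at every position of the row: position 0 is the index, and leaves of bare
  -- witnesses are unconstrained.
  s₋ = pr (a (pr (π₁ p) O))
          (call (startOp (entryOp v1)) (a (pr (π₁ p) (S O)) ∷ a (pr (π₁ p) O) ∷ []))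
  s₊ = ifZ (π₂ p) (π₁ c) (π₂ c)
    where
    c : Op 2 1
    c = call climbOp (call (leastOp (var v1 ⊖ π₁ (call climbOp (p ∷ [])))) (π₁ p ∷ π₁ p ∷ []) ∷ [])

  to′ : ∀ α x → Bare Zero (∃∞ ∷ ∀∞ ∷ []) α x →
        Bare Zero (∃∞ ∷ ∀₀ ∷ []) (s₋ · (α ∷ x ∷ [])) (thresholdη · (x ∷ []))
  to′ α x w n = ≗-∃∞ (∀₀ ∷ []) {λ ns _ → Zero ((thresholdη · (x ∷ [])) (nest ns))} (λ ns _ b → b)
    {β = λ _ → pair (k n) (s n)} (unpair (λ n _ → pair (k n) (s n)) n)
    ( ≤-trans (proj₁ (w n)) (m≤pair (k n) (s n))
    , λ j → trans (threshold-stage x (pair (k n) (s n)) j)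
           (trans (cong₂ (λ m t → stage x m t j) (fst-pair (k n) (s n)) (snd-pair (k n) (s n)))
                  (stage-zero x (k n) (s n) above (start-minimal (entry x (k n)) (t n)) j)) )
    where
    k t s : ℕ → ℕ
    k n = α (pair n 0)
    t n = α (pair n 1)
    s n = start (entry x (k n)) (t n)
    above : ∀ {j} → s n ≤ j → entry x (k n) j ≡ 0
    above {j} s≤j with t n ≤? j
    ... | yes t≤j = proj₂ (w n) j t≤j
    ... | no  t≰j = start-zero (entry x (k n)) (t n) s≤j (≰⇒> t≰j)

  from′ : ∀ α x → Bare Zero (∃∞ ∷ ∀₀ ∷ []) α (thresholdη · (x ∷ [])) →
          Bare Zero (∃∞ ∷ ∀∞ ∷ []) (s₊ · (α ∷ x ∷ [])) x
  from′ α x w n = ≗-∃∞ (∀∞ ∷ []) {λ ns _ → Zero (x (nest ns))} (λ ns _ b → b)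
    {β = λ m → ifz m (fst (c n)) (snd (c n))} (unpair (λ n m → ifz m (fst (c n)) (snd (c n))) n)
    ( injective-large (fst ∘ climb α) n distinct
    , λ j → ≤-entry x (fst (c n)) (snd (c n)) (valid (least (λ i → n ∸ fst (climb α i)) n)) )
    where
    c : ℕ → ℕ
    c n = climb α (least (λ i → n ∸ fst (climb α i)) n)
    valid : ∀ i k → stage x (fst (climb α i)) (snd (climb α i)) k ≡ 0
    valid zero    k = trans (sym (threshold-stage x (climb α 0) k)) (proj₂ (w 0) k)
    valid (suc i) k = trans (sym (threshold-stage x (climb α (suc i)) k))
                            (proj₂ (w (suc (climb α i))) k)
    distinct : ∀ {i j} → i < j → fst (climb α i) ≢ fst (climb α j)
    -- Equal first components have equal least thresholds, so the pairs coincide, although `climb`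
    -- increases strictly.
    distinct {i} {j} i<j eq = <⇒≢ (climb-mono {α} (proj₁ ∘ w) i<j) (begin
      climb α i                                      ≡⟨ pair-surjective (climb α i) ⟨
      pair (fst (climb α i)) (snd (climb α i))       ≡⟨ cong₂ pair eq (≤-antisym
        (stage-≤ x (fst (climb α j)) _ _ (valid j) valid-i)
        (stage-≤ x (fst (climb α j)) _ _ valid-i (valid j))) ⟩
      pair (fst (climb α j)) (snd (climb α j))       ≡⟨ pair-surjective (climb α j) ⟩
      climb α j                                      ∎)
      where
      open ≡-Reasoning
      valid-i : ∀ k → stage x (fst (climb α j)) (snd (climb α i)) k ≡ 0
      valid-i = subst (λ n → ∀ k → stage x n (snd (climb α i)) k ≡ 0) eq (valid i)

-- Duality of patterns.

dualP : Pattern → Pattern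
dualP = List.map dualQ

dualQ-involutive : ∀ q → dualQ (dualQ q) ≡ q
dualQ-involutive ∃₀ = refl
dualQ-involutive ∀₀ = refl
dualQ-involutive ∃∞ = refl
dualQ-involutive ∀∞ = refl

dualP-involutive : ∀ Q → dualP (dualP Q) ≡ Q
dualP-involutive []      = refl
dualP-involutive (q ∷ Q) = cong₂ _∷_ (dualQ-involutive q) (dualP-involutive Q)

≼-dual : ∀ {Q P} → Q ≼ P → dualP Q ≼ dualP P
≼-dual ≼-refl        = ≼-refl
≼-dual (≼-trans d e) = ≼-trans (≼-dual d) (≼-dual e)
≼-dual (≼-cong q d)  = ≼-cong (dualQ q) (≼-dual d)
≼-dual (≼-weaken q)  = ≼-weaken (dualQ q)
≼-dual ∀∀≼∀          = ∃∃≼∃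
≼-dual ∃∃≼∃          = ∀∀≼∀
≼-dual ∀∞≼∃∀         = ∃∞≼∀∃
≼-dual ∃∞≼∀∃         = ∀∞≼∃∀
≼-dual ∀≼∀∞          = ∃≼∃∞
≼-dual ∃≼∃∞          = ∀≼∀∞

mutual
  IsΣ-dual : ∀ {n Q} → IsΣ n Q → IsΠ n (dualP Q)
  IsΣ-dual [∃]     = [∀]
  IsΣ-dual [∀∞]    = [∃∞]
  IsΣ-dual (∃Σ h)  = ∀Π (IsΣ-dual h)
  IsΣ-dual (∀∞Σ h) = ∃∞Π (IsΣ-dual h)
  IsΣ-dual (∃Π h)  = ∀Σ (IsΠ-dual h)
  IsΣ-dual (∀∞Π h) = ∃∞Σ (IsΠ-dual h)

  IsΠ-dual : ∀ {n Q} → IsΠ n Q → IsΣ n (dualP Q)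
  IsΠ-dual [∀]     = [∃]
  IsΠ-dual [∃∞]    = [∀∞]
  IsΠ-dual (∀Σ h)  = ∃Π (IsΣ-dual h)
  IsΠ-dual (∃∞Σ h) = ∀∞Π (IsΣ-dual h)
  IsΠ-dual (∀Π h)  = ∃Σ (IsΠ-dual h)
  IsΠ-dual (∃∞Π h) = ∀∞Σ (IsΠ-dual h)

-- Normal forms of patterns up to `≋`.

infix 4 _≋_
_≋_ : Pattern → Pattern → Set
Q ≋ P = Q ≼ P × P ≼ Q

≋-trans : ∀ {Q P R} → Q ≋ P → P ≋ R → Q ≋ R
≋-trans (d , d′) (e , e′) = ≼-trans d e , ≼-trans e′ d′

≋-cong : ∀ q {Q P} → Q ≋ P → q ∷ Q ≋ q ∷ P
≋-cong q (d , d′) = ≼-cong q d , ≼-cong q d′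

∀∀≋∀ : ∀ {R} → ∀₀ ∷ ∀₀ ∷ R ≋ ∀₀ ∷ R
∀∀≋∀ = ∀∀≼∀ , ≼-weaken ∀₀

∃∃≋∃ : ∀ {R} → ∃₀ ∷ ∃₀ ∷ R ≋ ∃₀ ∷ R
∃∃≋∃ = ∃∃≼∃ , ≼-weaken ∃₀

-- The threshold of `∀∞` is absorbed by the `∃₀` in front.
∃∀∞≋∃∀ : ∀ {R} → ∃₀ ∷ ∀∞ ∷ R ≋ ∃₀ ∷ ∀₀ ∷ R
∃∀∞≋∃∀ = ≼-trans (≼-cong ∃₀ ∀∞≼∃∀) ∃∃≼∃ , ≼-cong ∃₀ ∀≼∀∞

∀∃∞≋∀∃ : ∀ {R} → ∀₀ ∷ ∃∞ ∷ R ≋ ∀₀ ∷ ∃₀ ∷ R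
∀∃∞≋∀∃ = ≼-trans (≼-cong ∀₀ ∃∞≼∀∃) ∀∀≼∀ , ≼-cong ∀₀ ∃≼∃∞

∃∀∞∀≋∃∀ : ∀ {R} → ∃₀ ∷ ∀∞ ∷ ∀₀ ∷ R ≋ ∃₀ ∷ ∀₀ ∷ R
∃∀∞∀≋∃∀ = ≋-trans ∃∀∞≋∃∀ (≋-cong ∃₀ ∀∀≋∀)

-- Inverting a derivation of `IsΠ 1` or `IsΣ 2` leaves cases built from level 0, which this
-- discards.
¬Σ₀ : ∀ {Q} → ¬ IsΣ 0 Q
¬Σ₀ (∃Σ h) = ¬Σ₀ h

infix 4 _≋∈_
_≋∈_ : Pattern → List Pattern → Set
Q ≋∈ Ps = ∃[ P ] (P ∈ Ps × Q ≋ P)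

Π₁-patterns : ∀ {Q} → IsΠ 1 Q → Q ≋ ∀₀ ∷ []
Π₁-patterns [∀]     = ≼-refl , ≼-refl
Π₁-patterns (∀Σ h)  with () ← ¬Σ₀ h
Π₁-patterns (∃∞Σ h) with () ← ¬Σ₀ h
Π₁-patterns (∀Π h)  = ≋-trans (≋-cong ∀₀ (Π₁-patterns h)) ∀∀≋∀

Σ₂-patterns : ∀ {Q} → IsΣ 2 Q → Q ≋∈
  (∀∞ ∷ []) ∷ (∀∞ ∷ ∀₀ ∷ []) ∷ (∃₀ ∷ ∀₀ ∷ []) ∷ []
Σ₂-patterns [∀∞]    = _ , here refl , ≼-refl , ≼-refl
Σ₂-patterns (∀∞Π h) = _ , there (here refl) , ≋-cong ∀∞ (Π₁-patterns h)
Σ₂-patterns (∃Π h)  = _ , there (there (here refl)) , ≋-cong ∃₀ (Π₁-patterns h)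
Σ₂-patterns (∀∞Σ h) with () ← ¬Σ₀ h
Σ₂-patterns (∃Σ h)  = _ , there (there (here refl)) , ∃-absorbs (Σ₂-patterns h)
  where
  ∃-absorbs : ∀ {Q} → Q ≋∈ (∀∞ ∷ []) ∷ (∀∞ ∷ ∀₀ ∷ []) ∷ (∃₀ ∷ ∀₀ ∷ []) ∷ [] → ∃₀ ∷ Q ≋ ∃₀ ∷ ∀₀ ∷ []
  ∃-absorbs (_ , here refl , e)                 = ≋-trans (≋-cong ∃₀ e) ∃∀∞≋∃∀
  ∃-absorbs (_ , there (here refl) , e)         = ≋-trans (≋-cong ∃₀ e) ∃∀∞∀≋∃∀
  ∃-absorbs (_ , there (there (here refl)) , e) = ≋-trans (≋-cong ∃₀ e) ∃∃≋∃

pattern 0th = here refl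
pattern 1st = there 0th
pattern 2nd = there 1st
pattern 3rd = there 2nd
pattern 4th = there 3rd
pattern 5th = there 4th
pattern 6th = there 5th

Π₃-representatives : List Pattern
Π₃-representatives =
    (∀₀ ∷ ∃₀ ∷ ∀₀ ∷ [])
  ∷ (∃∞ ∷ ∃₀ ∷ ∀₀ ∷ [])
  ∷ (∃∞ ∷ ∀∞ ∷ ∀₀ ∷ [])
  ∷ (∃∞ ∷ ∀∞ ∷ [])
  ∷ (∃∞ ∷ ∀₀ ∷ [])
  ∷ (∀₀ ∷ ∀∞ ∷ ∀₀ ∷ [])
  ∷ (∀₀ ∷ ∀∞ ∷ [])
  ∷ []

Π₃-patterns : ∀ {Q} → IsΠ 3 Q → Q ≋∈ Π₃-representatives
Π₃-patterns (∀Σ h) with Σ₂-patterns h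
... | _ , 0th , e = _ , 6th , ≋-cong ∀₀ e
... | _ , 1st , e = _ , 5th , ≋-cong ∀₀ e
... | _ , 2nd , e = _ , 0th , ≋-cong ∀₀ e
Π₃-patterns (∃∞Σ h) with Σ₂-patterns h
... | _ , 0th , e = _ , 3rd , ≋-cong ∃∞ e
... | _ , 1st , e = _ , 2nd , ≋-cong ∃∞ e
... | _ , 2nd , e = _ , 1st , ≋-cong ∃∞ e
Π₃-patterns (∃∞Π h) = _ , 4th , ≋-cong ∃∞ (Π₁-patterns h)
-- A leading `∀₀` turns all four representatives that begin with `∃∞` into ∀∃∀; the other three
-- absorb it.
Π₃-patterns (∀Π h) with Π₃-patterns h
... | _ , 0th , e = _ , 0th , ≋-trans (≋-cong ∀₀ e) ∀∀≋∀
... | _ , 1st , e = _ , 0th , ≋-trans (≋-cong ∀₀ e) (≋-trans ∀∃∞≋∀∃ (≋-cong ∀₀ ∃∃≋∃))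
... | _ , 2nd , e = _ , 0th , ≋-trans (≋-cong ∀₀ e) (≋-trans ∀∃∞≋∀∃ (≋-cong ∀₀ ∃∀∞∀≋∃∀))
... | _ , 3rd , e = _ , 0th , ≋-trans (≋-cong ∀₀ e) (≋-trans ∀∃∞≋∀∃ (≋-cong ∀₀ ∃∀∞≋∃∀))
... | _ , 4th , e = _ , 0th , ≋-trans (≋-cong ∀₀ e) ∀∃∞≋∀∃
... | _ , 5th , e = _ , 5th , ≋-trans (≋-cong ∀₀ e) ∀∀≋∀
... | _ , 6th , e = _ , 6th , ≋-trans (≋-cong ∀₀ e) ∀∀≋∀

Σ₃-patterns : ∀ {Q} → IsΣ 3 Q → Q ≋∈ List.map dualP Π₃-representatives
Σ₃-patterns {Q} h with Π₃-patterns (IsΣ-dual h)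
... | P , P∈ , d , d′ = dualP P , ∈-map⁺ dualP P∈ ,
  subst (_≼ dualP P) (dualP-involutive Q) (≼-dual d) ,
  subst (dualP P ≼_) (dualP-involutive Q) (≼-dual d′)

-- The coarser classes up to `≤ₘ`.

infix 4 _⊑_ _≅_
_⊑_ _≅_ : Pattern → Pattern → Set
Q ⊑ P = Σ (Op 1 1) (Reduction Zero (fromList Q) (fromList P))
Q ≅ P = Q ⊑ P × P ⊑ Q

≼⇒⊑ : ∀ {Q P} → Q ≼ P → Q ⊑ P
≼⇒⊑ d with ≼-sound d
... | η , f , _ = η , f

⊑-trans : ∀ {Q P R} → Q ⊑ P → P ⊑ R → Q ⊑ R
⊑-trans (_ , f) (_ , g) = _ , reduction-trans f g

⊑-cong : ∀ q {Q P} → Q ⊑ P → q ∷ Q ⊑ q ∷ P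
⊑-cong q (_ , f) = _ , reduction-cong q f

≅-trans : ∀ {Q P R} → Q ≅ P → P ≅ R → Q ≅ R
≅-trans (d , d′) (e , e′) = ⊑-trans d e , ⊑-trans e′ d′

≅-cong : ∀ q {Q P} → Q ≅ P → q ∷ Q ≅ q ∷ P
≅-cong q (d , d′) = ⊑-cong q d , ⊑-cong q d′

≋⇒≅ : ∀ {Q P} → Q ≋ P → Q ≅ P
≋⇒≅ (d , d′) = ≼⇒⊑ d , ≼⇒⊑ d′

≅⇒≡ₘ : ∀ {Q P} → Q ≅ P → ⟨ Q ⟩ ≡ₘ ⟨ P ⟩
≅⇒≡ₘ ((_ , f) , (_ , g)) = (_ , reduction⇒≤ₘ f) , (_ , reduction⇒≤ₘ g)

≋⇒≡dm : ∀ {Q P} → Q ≋ P → ⟨ Q ⟩ ≡dm ⟨ P ⟩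
≋⇒≡dm (d , d′) = ≼⇒≤dm d , ≼⇒≤dm d′

∀∃≅∃∞ : ∀₀ ∷ ∃₀ ∷ [] ≅ ∃∞ ∷ []
∀∃≅∃∞ = (_ , ∀∃≤∃∞) , ≼⇒⊑ ∃∞≼∀∃

∃∞∃≅∀∃ : ∃∞ ∷ ∃₀ ∷ [] ≅ ∀₀ ∷ ∃₀ ∷ []
∃∞∃≅∀∃ = ≼⇒⊑ (≼-trans ∃∞≼∀∃ (≼-cong ∀₀ ∃∃≼∃)) ,
         ⊑-trans (_ , ∀∃≤∃∞) (≼⇒⊑ (≼-cong ∃∞ (≼-weaken ∃₀)))

∃∞∃∀≅∀∃∀ : ∃∞ ∷ ∃₀ ∷ ∀₀ ∷ [] ≅ ∀₀ ∷ ∃₀ ∷ ∀₀ ∷ []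
∃∞∃∀≅∀∃∀ = ≼⇒⊑ (≼-trans ∃∞≼∀∃ (≼-cong ∀₀ ∃∃≼∃)) ,
           -- The `∀₀` introduced by the histories merges with the one already there.
           ⊑-trans (_ , ∀∃≤∃∞∃∀) (≼⇒⊑ (≼-cong ∃∞ (≼-cong ∃₀ ∀∀≼∀)))

∃∞∀∞≅∃∞∀ : ∃∞ ∷ ∀∞ ∷ [] ≅ ∃∞ ∷ ∀₀ ∷ []
∃∞∀∞≅∃∞∀ = (_ , ∃∞∀∞≤∃∞∀) , ≼⇒⊑ (≼-cong ∃∞ ∀≼∀∞)

-- Since ∀∃, ∃∞∃ and ∃∞ agree up to `≅`, the three dual representatives that put `∀∞` before them
-- become one class, and those with `∃₀` before them become ∃∀∃.
Σ₃-classes : ∀ Q → IsΣ 3 Q → ∃[ P ]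
  (P ∈ (∃₀ ∷ ∀₀ ∷ ∃₀ ∷ [])
     ∷ (∀∞ ∷ ∃∞ ∷ [])
     ∷ (∀∞ ∷ ∃₀ ∷ [])
     ∷ [])
  × ⟨ Q ⟩ ≡ₘ ⟨ P ⟩
Σ₃-classes Q h with Σ₃-patterns h
... | _ , 0th , e = _ , 0th , ≅⇒≡ₘ (≋⇒≅ e)
... | _ , 1st , e = _ , 1st , ≅⇒≡ₘ (≅-trans (≋⇒≅ e) (≅-cong ∀∞ ∀∃≅∃∞))
... | _ , 2nd , e = _ , 1st , ≅⇒≡ₘ (≅-trans (≋⇒≅ e) (≅-cong ∀∞ (≅-trans ∃∞∃≅∀∃ ∀∃≅∃∞)))
... | _ , 3rd , e = _ , 1st , ≅⇒≡ₘ (≋⇒≅ e)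
... | _ , 4th , e = _ , 2nd , ≅⇒≡ₘ (≋⇒≅ e)
... | _ , 5th , e = _ , 0th , ≅⇒≡ₘ (≅-trans (≋⇒≅ e) (≅-cong ∃₀ ∃∞∃≅∀∃))
... | _ , 6th , e = _ , 0th , ≅⇒≡ₘ (≅-trans (≋⇒≅ e) (≅-cong ∃₀ (swap ∀∃≅∃∞)))

-- Two of the seven are merged into others: ∃∞∃∀ into ∀∃∀, and ∃∞∀∞ into ∃∞∀.
Π₃-classes : ∀ Q → IsΠ 3 Q → ∃[ P ]
  (P ∈ (∀₀ ∷ ∃₀ ∷ ∀₀ ∷ [])
     ∷ (∃∞ ∷ ∀∞ ∷ ∀₀ ∷ [])
     ∷ (∃∞ ∷ ∀₀ ∷ [])
     ∷ (∀₀ ∷ ∀∞ ∷ ∀₀ ∷ [])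
     ∷ (∀₀ ∷ ∀∞ ∷ [])
     ∷ [])
  × ⟨ Q ⟩ ≡ₘ ⟨ P ⟩
Π₃-classes Q h with Π₃-patterns h
... | _ , 0th , e = _ , 0th , ≅⇒≡ₘ (≋⇒≅ e)
... | _ , 1st , e = _ , 0th , ≅⇒≡ₘ (≅-trans (≋⇒≅ e) ∃∞∃∀≅∀∃∀)
... | _ , 2nd , e = _ , 1st , ≅⇒≡ₘ (≋⇒≅ e)
... | _ , 3rd , e = _ , 2nd , ≅⇒≡ₘ (≅-trans (≋⇒≅ e) ∃∞∀∞≅∃∞∀)
... | _ , 4th , e = _ , 2nd , ≅⇒≡ₘ (≋⇒≅ e)
... | _ , 5th , e = _ , 3rd , ≅⇒≡ₘ (≋⇒≅ e)
... | _ , 6th , e = _ , 4th , ≅⇒≡ₘ (≋⇒≅ e)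

Π₃-dm-classes : ∀ Q → IsΠ 3 Q → ∃[ P ] P ∈ Π₃-representatives × ⟨ Q ⟩ ≡dm ⟨ P ⟩
Π₃-dm-classes Q h with Π₃-patterns h
... | P , P∈ , e = P , P∈ , ≋⇒≡dm e

theorem4p1 : (∀ Q → IsΣ 3 Q → ∃[ P ]
    (P ∈ (∃₀ ∷ ∀₀ ∷ ∃₀ ∷ [])
    ∷ (∀∞ ∷ ∃∞ ∷ [])
    ∷ (∀∞ ∷ ∃₀ ∷ [])
    ∷ [])
    × ⟨ Q ⟩ ≡ₘ ⟨ P ⟩)
    × (∀ Q → IsΠ 3 Q → ∃[ P ]
    (P ∈ (∀₀ ∷ ∃₀ ∷ ∀₀ ∷ [])
    ∷ (∃∞ ∷ ∀∞ ∷ ∀₀ ∷ [])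
    ∷ (∃∞ ∷ ∀₀ ∷ [])
    ∷ (∀₀ ∷ ∀∞ ∷ ∀₀ ∷ [])
    ∷ (∀₀ ∷ ∀∞ ∷ [])
    ∷ [])
    × ⟨ Q ⟩ ≡ₘ ⟨ P ⟩)
    × (∀ Q → IsΠ 3 Q → ∃[ P ]
    (P ∈ (∀₀ ∷ ∃₀ ∷ ∀₀ ∷ [])
    ∷ (∃∞ ∷ ∃₀ ∷ ∀₀ ∷ [])
    ∷ (∃∞ ∷ ∀∞ ∷ ∀₀ ∷ [])
    ∷ (∃∞ ∷ ∀∞ ∷ [])
    ∷ (∃∞ ∷ ∀₀ ∷ [])
    ∷ (∀₀ ∷ ∀∞ ∷ ∀₀ ∷ [])
    ∷ (∀₀ ∷ ∀∞ ∷ [])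
    ∷ [])
    × ⟨ Q ⟩ ≡dm ⟨ P ⟩)
theorem4p1 = Σ₃-classes , Π₃-classes , Π₃-dm-classes
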